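{- Let $C_1, C_2, \dots, C_h$ be $h$ caterpillars, each with $n$ vertices, such that $C_i$ is $\Delta_i$-regular for $1\le i\le h$, and $\Delta_h \le \Delta_{h-1}\le\dots\le\Delta_1\le n-h$. If $$\sum_{i=1}^h \Delta_i \le n-1 \quad\text{and}\quad \sum_{i=2}^h \left\lceil \frac{\Delta_i}{2}\right\rceil < \frac{n-(\Delta_1-1)}{2},$$ then there exists a $k$-planar packing of $C_1,\dots,C_h$ with $k\in O(\Delta_1 h^2)$; that is, there is an absolute constant $c>0$, independent of $h$, $n$ and the caterpillars, such that a $k$-planar packing exists with $k\le c\,\Delta_1 h^2$.
   Context: Graphs are finite and simple. A caterpillar is a tree such that removing all its leaves leaves a path, called the spine. For $\Delta\ge 2$, a caterpillar $T$ is $\Delta$-regular if every spine vertex has degree $\Delta$ in $T$; its number of vertices is then $n=\sigma(\Delta-1)+2$, where the positive integer $\sigma$ is the number of spine vertices. A packing of $n$-vertex graphs $G_1,\dots,G_h$ is an $n$-vertex graph $G$ (the host graph) that contains (isomorphic copies of) $G_1,\dots,G_h$ as pairwise edge-disjoint spanning subgraphs. A graph is $k$-planar if it admits a drawing in the plane in which each edge is crossed at most $k$ times. A packing is $k$-planar if its host graph is $k$-planar. -}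

module Defs where

import Algebra.Properties.CommutativeMonoid.Sum
open import Data.Bool.Base using (Bool; false; T)
open import Data.Fin.Base as Fin using (Fin; toℕ)
open import Data.Fin.Permutation using (Permutation′; _⟨$⟩ʳ_)
open import Data.List.Base using (List; _∷_; _∷ʳ_; length; filterᵇ; allFin)
open import Data.List.Relation.Unary.AllPairs using (AllPairs)
open import Data.List.Relation.Unary.Linked using (Linked)
open import Data.List.Relation.Unary.Unique.Propositional using (Unique)
open import Data.Nat.Base as ℕ using (ℕ; suc)
open import Data.Nat.Properties using (+-0-commutativeMonoid; ≤-refl)
open import Data.Product.Base using (_×_; _,_; ∃-syntax)
open import Data.Rational.Base as ℚ using (ℚ; 0ℚ; 1ℚ)
import Data.Rational.Properties as ℚₚ
open import Data.Sum.Base using (_⊎_)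
open import Function.Bundles using (_⇔_)
open import Function.Definitions using (Injective)
open import Relation.Binary.Construct.Closure.ReflexiveTransitive using (Star)
open import Relation.Binary.PropositionalEquality
  using (_≡_; _≢_; refl; subst; sym)
open import Relation.Nullary.Negation.Core using (¬_)

open Algebra.Properties.CommutativeMonoid.Sum +-0-commutativeMonoid public
  using (sum)

------------------------------------------------------------------------
-- Finite simple graphs

record Graph (n : ℕ) : Set where
  field
    adjacent    : Fin n → Fin n → Bool
    symmetric   : ∀ u v → adjacent u v ≡ adjacent v u
    irreflexive : ∀ v → adjacent v v ≡ false

  infix 4 _~_
  _~_ : Fin n → Fin n → Set
  u ~ v = T (adjacent u v)

  degree : Fin n → ℕ
  degree v = length (filterᵇ (adjacent v) (allFin n))

  IsLeaf : Fin n → Set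
  IsLeaf v = degree v ≡ 1

  Connected : Set
  Connected = ∀ u v → Star _~_ u v

  -- A cycle is v ∷ vs, traversed in order and closed up at v.
  Acyclic : Set
  Acyclic = ∀ v vs → 2 ℕ.≤ length vs → Unique (v ∷ vs) →
            ¬ Linked _~_ (v ∷ (vs ∷ʳ v))

------------------------------------------------------------------------
-- Caterpillars

Consecutive : ∀ {σ} → Fin σ → Fin σ → Set
Consecutive i j = suc (toℕ i) ≡ toℕ j ⊎ suc (toℕ j) ≡ toℕ i

-- An isomorphism from the path with σ vertices onto the subgraph of T
-- induced by its non-leaves.
record Spine {n} (T : Graph n) : Set where
  open Graph T
  field
    σ         : ℕ
    vertex    : Fin σ → Fin n
    injective : Injective _≡_ _≡_ vertex
    nonLeaf   : ∀ i → ¬ IsLeaf (vertex i)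
    covers    : ∀ v → ¬ IsLeaf v → ∃[ i ] vertex i ≡ v
    path      : ∀ i j → vertex i ~ vertex j ⇔ Consecutive i j

record Caterpillar {n} (T : Graph n) : Set where
  open Graph T
  field
    connected : Connected
    acyclic   : Acyclic
    spine     : Spine T

record RegularCaterpillar {n} (Δ : ℕ) (T : Graph n) : Set where
  field
    caterpillar : Caterpillar T

  open Caterpillar caterpillar public
  open Spine spine public using (σ; vertex)

  field
    2≤Δ     : 2 ℕ.≤ Δ
    0<σ     : 0 ℕ.< σ
    regular : ∀ i → Graph.degree T (vertex i) ≡ Δ

------------------------------------------------------------------------
-- Packings

record Packing {h n} (C : Fin h → Graph n) (G : Graph n) : Set where
  field
    place        : Fin h → Permutation′ n
    contained    : ∀ i u v → Graph._~_ (C i) u v →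
                   Graph._~_ G (place i ⟨$⟩ʳ u) (place i ⟨$⟩ʳ v)
    -- Since adjacency is symmetric, comparing ordered endpoint pairs
    -- suffices.
    edgeDisjoint : ∀ i j → i ≢ j → ∀ u v u′ v′ →
                   Graph._~_ (C i) u v → Graph._~_ (C j) u′ v′ →
                   ¬ (place i ⟨$⟩ʳ u ≡ place j ⟨$⟩ʳ u′ ×
                      place i ⟨$⟩ʳ v ≡ place j ⟨$⟩ʳ v′)

------------------------------------------------------------------------
-- The real numbers, as Cauchy sequences of rationals; the equality of
-- real numbers is _≈_.

Eventually : (ℕ → Set) → Set
Eventually P = ∃[ N ] ∀ n → N ℕ.≤ n → P n

record ℝ : Set where
  field
    approx : ℕ → ℚ
    cauchy : ∀ ε → 0ℚ ℚ.< ε →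
             ∃[ N ] ∀ m n → N ℕ.≤ m → N ℕ.≤ n →
             ℚ.∣ approx m ℚ.- approx n ∣ ℚ.< ε

open ℝ public

fromℚ : ℚ → ℝ
fromℚ q .approx _ = q
fromℚ q .cauchy ε 0<ε =
  0 , λ _ _ _ _ → subst (λ d → ℚ.∣ d ∣ ℚ.< ε) (sym (ℚₚ.+-inverseʳ q)) 0<ε

-- Implied by ∣ x - y ∣ < ε and implying ∣ x - y ∣ ≤ ε.
Near : ℚ → ℝ → ℝ → Set
Near ε x y = Eventually λ n → ℚ.∣ approx x n ℚ.- approx y n ∣ ℚ.< ε

infix 4 _≈_ _<_ _≤_

_≈_ : ℝ → ℝ → Set
x ≈ y = ∀ ε → 0ℚ ℚ.< ε → Near ε x y

_<_ : ℝ → ℝ → Set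
x < y = ∃[ ε ] 0ℚ ℚ.< ε × Eventually λ n → approx x n ℚ.+ ε ℚ.< approx y n

_≤_ : ℝ → ℝ → Set
x ≤ y = ¬ (y < x)

fromℚ-mono-≤ : ∀ {p q} → p ℚ.≤ q → fromℚ p ≤ fromℚ q
fromℚ-mono-≤ {p} {q} p≤q (ε , 0<ε , N , q+ε<p) =
  ℚₚ.<-irrefl refl (ℚₚ.<-≤-trans q<p p≤q)
  where
  q<p : q ℚ.< p
  q<p = ℚₚ.<-trans
    (subst (ℚ._< q ℚ.+ ε) (ℚₚ.+-identityʳ q) (ℚₚ.+-monoʳ-< q 0<ε))
    (q+ε<p N ≤-refl)

------------------------------------------------------------------------
-- Arcs in the plane

record Point : Set where
  constructor point
  field
    x-coord y-coord : ℝ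

open Point public

infix 4 _≈ᴾ_

_≈ᴾ_ : Point → Point → Set
p ≈ᴾ q = x-coord p ≈ x-coord q × y-coord p ≈ y-coord q

Nearᴾ : ℚ → Point → Point → Set
Nearᴾ ε p q = Near ε (x-coord p) (x-coord q) × Near ε (y-coord p) (y-coord q)

record UnitInterval : Set where
  field
    value : ℝ
    0≤    : fromℚ 0ℚ ≤ value
    ≤1    : value ≤ fromℚ 1ℚ

open UnitInterval public

0≤1 : 0ℚ ℚ.≤ 1ℚ
0≤1 = ℚₚ.nonNegative⁻¹ 1ℚ

0ᴵ 1ᴵ : UnitInterval
0ᴵ = record { value = fromℚ 0ℚ ; 0≤ = fromℚ-mono-≤ ℚₚ.≤-refl ; ≤1 = fromℚ-mono-≤ 0≤1 }
1ᴵ = record { value = fromℚ 1ℚ ; 0≤ = fromℚ-mono-≤ 0≤1 ; ≤1 = fromℚ-mono-≤ ℚₚ.≤-refl }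

Interior : UnitInterval → Set
Interior t = fromℚ 0ℚ < value t × value t < fromℚ 1ℚ

-- Continuity makes `at` respect _≈_.
record Arc (p q : Point) : Set where
  field
    at         : UnitInterval → Point
    continuous : ∀ s ε → 0ℚ ℚ.< ε →
                 ∃[ δ ] 0ℚ ℚ.< δ ×
                 (∀ t → Near δ (value s) (value t) → Nearᴾ ε (at s) (at t))
    injective  : ∀ s t → at s ≈ᴾ at t → value s ≈ value t
    start      : at 0ᴵ ≈ᴾ p
    end        : at 1ᴵ ≈ᴾ q

------------------------------------------------------------------------
-- Drawings and k-planarity

-- An unordered pair of adjacent vertices, listed in increasing order.
record Edge {n} (G : Graph n) : Set where
  field
    tail head : Fin n
    tail<head : tail Fin.< head
    joined    : Graph._~_ G tail head

record Drawing {n} (G : Graph n) : Set where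
  open Edge
  field
    position       : Fin n → Point
    distinct       : ∀ u v → position u ≈ᴾ position v → u ≡ v
    arc            : (e : Edge G) → Arc (position (tail e)) (position (head e))
    avoidsVertices : ∀ e t → Interior t → ∀ v → ¬ (Arc.at (arc e) t ≈ᴾ position v)

  -- A point in the interior of e that also lies in the interior of another
  -- edge. A point lying on several other edges counts once for each.
  record Crossing (e : Edge G) : Set where
    field
      other   : Edge G
      other≢e : other ≢ e
      s t     : UnitInterval
      s-inner : Interior s
      t-inner : Interior t
      meet    : Arc.at (arc e) s ≈ᴾ Arc.at (arc other) t

  -- As arcs are injective, the parameter on e determines the point.
  SameCrossing : ∀ {e} → Crossing e → Crossing e → Set
  SameCrossing c d = Crossing.other c ≡ Crossing.other d ×
                     value (Crossing.s c) ≈ value (Crossing.s d)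

  CrossedAtMost : ℕ → Edge G → Set
  CrossedAtMost k e = (cs : List (Crossing e)) →
                      AllPairs (λ c d → ¬ SameCrossing c d) cs → length cs ℕ.≤ k

record KPlanar (k : ℕ) {n} (G : Graph n) : Set where
  field
    drawing       : Drawing G
    crossedAtMost : ∀ e → Drawing.CrossedAtMost drawing k e

{-# OPTIONS --safe #-}

-- The host graph is drawn with its vertices 0, …, n - 1 on a parabola and with
-- straight edges, so two edges cross only if their ends interleave.
--
-- Traversing a Δ-regular caterpillar spine vertex by spine vertex, put the new
-- vertices of a block to the right of everything placed so far, those of the next
-- block to the left, and so on. Then the t-th edge joins the two extreme positions
-- a, b placed so far: b - a = t, and a + b oscillates within a window of Δ
-- consecutive values. Positions are read modulo n, and rotating the i-th caterpillar
-- by r i moves its window by 2 (r i). If these windows are put side by side, then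
-- edges of different caterpillars with the same span t have different sums; as all
-- the windows lie in one window of width D ≤ n, edges with spans t and n - t do not
-- coincide modulo n either.
--
-- For two edges with spans t, t′ and sums S, S′ one of the intervals [a , b],
-- [a′ , b′] contains the other unless ∣ t - t′ ∣ < ∣ S - S′ ∣ < D, and chords over
-- nested intervals do not cross. So an edge is crossed by fewer than 2 D edges of each
-- caterpillar, and D ≤ 2 h (Δ zero).
module Submission where

open import Defs
open import Data.Bool.Base using (Bool; true; false; not; if_then_else_; T)
open import Data.Bool.Properties using (T?; T-irrelevant)
open import Data.Empty using (⊥; ⊥-elim)
open import Data.Fin.Base as Fin using (Fin; zero; suc; toℕ; fromℕ<; inject₁; combine; remQuot)
open import Data.Fin.Permutation using (Permutation′; permutation; _⟨$⟩ʳ_; _⟨$⟩ˡ_; inverseˡ; inverseʳ)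
import Data.Fin.Properties as Finₚ
open import Data.List.Base using (List; []; _∷_; _∷ʳ_; _++_; length; lookup; filter; allFin)
open import Data.List.Membership.Propositional using (_∈_; _∉_)
open import Data.List.Membership.Propositional.Properties
  using (∈-filter⁺; ∈-filter⁻; ∈-allFin; ∈-lookup; ∈-∃++)
open import Data.List.Properties using (length-map)
open import Data.List.Relation.Binary.Permutation.Propositional
  using (_↭_; ↭-refl; ↭-sym; ↭-trans; ↭⇒↭ₛ)
open import Data.List.Relation.Binary.Permutation.Propositional.Properties
  using (∈-resp-↭; ↭-length; ∷↭∷ʳ) renaming (shift to ↭-shift)
import Data.List.Relation.Binary.Permutation.Setoid.Properties as PermutationSetoid
open import Data.List.Relation.Unary.All as All using ([]; _∷_)
open import Data.List.Relation.Unary.AllPairs as AllPairs using (AllPairs; []; _∷_)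
import Data.List.Relation.Unary.AllPairs.Properties as AllPairsₚ
open import Data.List.Relation.Unary.Any as Any using (here; there)
open import Data.List.Relation.Unary.Unique.Propositional using (Unique)
open import Data.List.Relation.Unary.Unique.Propositional.Properties
  using (filter⁺; allFin⁺; Unique[x∷xs]⇒x∉xs)
open import Data.Nat.Base as ℕ using (ℕ; zero; suc; _+_; _*_; _∸_; _^_; ⌈_/2⌉; z≤n; s≤s)
open import Data.Nat.DivMod
  using (_/_; _%_; m≡m%n+[m/n]*n; m%n<n; m<n⇒m%n≡m; [m+n]%n≡m%n; [m+kn]%n≡m%n)
import Data.Nat.Properties as ℕₚ
open import Data.Nat.Tactic.RingSolver using (solve-∀)
open import Data.Product.Base using (_×_; _,_; ∃-syntax; proj₁; proj₂)
open import Data.Rational.Base as ℚ using (ℚ; 0ℚ; 1ℚ; ½)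
import Data.Rational.Properties as ℚₚ
open import Data.Rational.Solver using (module +-*-Solver)
open import Data.Sum.Base using (_⊎_; inj₁; inj₂)
open import Function.Base using (_∘_)
open import Function.Bundles using (Equivalence; _⇔_; mk⇔)
open import Function.Definitions using (Injective)
open import Relation.Binary.Construct.Closure.ReflexiveTransitive as Star using (Star; _◅_)
open import Relation.Binary.Definitions using (tri<; tri≈; tri>)
open import Relation.Binary.PropositionalEquality
  using (_≡_; _≢_; refl; sym; trans; cong; subst; subst₂; setoid; module ≡-Reasoning)
open import Relation.Nullary using (¬_; Dec; yes; no)
open import Relation.Nullary.Decidable
  using (isYes; toWitness; fromWitness; isYes≗does; does-⇔; dec-false)

-- Null sequences of rationals

-- `x ≈ y` unfolds to `Null` of the difference of the approximations, so equations between reals can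
-- be combined linearly as null sequences.
Null : (ℕ → ℚ) → Set
Null f = ∀ ε → 0ℚ ℚ.< ε → Eventually λ n → ℚ.∣ f n ∣ ℚ.< ε

Eventually-× : ∀ {P Q : ℕ → Set} → Eventually P → Eventually Q →
               Eventually (λ n → P n × Q n)
Eventually-× (M , p) (N , q) = M ℕ.⊔ N , λ n le →
  p n (ℕₚ.≤-trans (ℕₚ.m≤m⊔n M N) le) , q n (ℕₚ.≤-trans (ℕₚ.m≤n⊔m M N) le)

Eventually-map : ∀ {P Q : ℕ → Set} → (∀ n → P n → Q n) → Eventually P → Eventually Q
Eventually-map f (N , p) = N , λ n le → f n (p n le)

*-pos : ∀ {p q} → 0ℚ ℚ.< p → 0ℚ ℚ.< q → 0ℚ ℚ.< p ℚ.* q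
*-pos {p} {q} 0<p 0<q = ℚₚ.positive⁻¹ _
  {{ℚₚ.pos*pos⇒pos p {{ℚ.positive 0<p}} q {{ℚ.positive 0<q}}}}

*-nonNeg : ∀ {p q} → 0ℚ ℚ.≤ p → 0ℚ ℚ.≤ q → 0ℚ ℚ.≤ p ℚ.* q
*-nonNeg {p} {q} 0≤p 0≤q = ℚₚ.nonNegative⁻¹ _
  {{ℚₚ.nonNeg*nonNeg⇒nonNeg p {{ℚ.nonNegative 0≤p}} q {{ℚ.nonNegative 0≤q}}}}

*-cancel-0 : ∀ p {q} → p ≢ 0ℚ → p ℚ.* q ≡ 0ℚ → q ≡ 0ℚ
*-cancel-0 p {q} p≢0 pq≡0 = begin
  q                    ≡⟨ ℚₚ.*-identityˡ q ⟨
  1ℚ ℚ.* q             ≡⟨ cong (ℚ._* q) (ℚₚ.*-inverseˡ p) ⟨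
  ℚ.1/ p ℚ.* p ℚ.* q   ≡⟨ ℚₚ.*-assoc (ℚ.1/ p) p q ⟩
  ℚ.1/ p ℚ.* (p ℚ.* q) ≡⟨ cong (ℚ.1/ p ℚ.*_) pq≡0 ⟩
  ℚ.1/ p ℚ.* 0ℚ        ≡⟨ ℚₚ.*-zeroʳ (ℚ.1/ p) ⟩
  0ℚ                   ∎
  where
  open ≡-Reasoning
  instance
    p-nonZero : ℚ.NonZero p
    p-nonZero = ℚ.≢-nonZero p≢0

p-q≡0⇒p≡q : ∀ p q → p ℚ.- q ≡ 0ℚ → p ≡ q
p-q≡0⇒p≡q p q eq = begin
  p               ≡⟨ solve 2 (λ p q → p := (p :- q) :+ q) refl p q ⟩
  p ℚ.- q ℚ.+ q   ≡⟨ cong (ℚ._+ q) eq ⟩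
  0ℚ ℚ.+ q        ≡⟨ ℚₚ.+-identityˡ q ⟩
  q               ∎
  where open ≡-Reasoning; open +-*-Solver

p<q⇒0<q-p : ∀ {p q} → p ℚ.< q → 0ℚ ℚ.< q ℚ.- p
p<q⇒0<q-p {p} {q} p<q = subst (ℚ._< q ℚ.- p) (ℚₚ.+-inverseʳ p) (ℚₚ.+-monoˡ-< (ℚ.- p) p<q)

p≤q⇒0≤q-p : ∀ {p q} → p ℚ.≤ q → 0ℚ ℚ.≤ q ℚ.- p
p≤q⇒0≤q-p {p} {q} p≤q = subst (ℚ._≤ q ℚ.- p) (ℚₚ.+-inverseʳ p) (ℚₚ.+-monoˡ-≤ (ℚ.- p) p≤q)

∣∣-bound-* : ∀ c ε → 0ℚ ℚ.< ε →
             ∃[ δ ] 0ℚ ℚ.< δ × (∀ x → ℚ.∣ x ∣ ℚ.< δ → ℚ.∣ c ℚ.* x ∣ ℚ.< ε)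
∣∣-bound-* c ε 0<ε = δ , *-pos 0<ε (ℚₚ.positive⁻¹ _ {{ℚₚ.1/pos⇒pos K}}) , bound
  where
  K : ℚ
  -- The summand 1 keeps the divisor positive even when `c` is 0.
  K = ℚ.∣ c ∣ ℚ.+ 1ℚ
  instance
    K-pos : ℚ.Positive K
    K-pos = ℚₚ.nonNeg+pos⇒pos ℚ.∣ c ∣ {{ℚₚ.∣-∣-nonNeg c}} 1ℚ
    K-nonZero : ℚ.NonZero K
    K-nonZero = ℚₚ.pos⇒nonZero K
  δ : ℚ
  δ = ε ℚ.* ℚ.1/ K
  bound : ∀ x → ℚ.∣ x ∣ ℚ.< δ → ℚ.∣ c ℚ.* x ∣ ℚ.< ε
  bound x x<δ = begin-strict
    ℚ.∣ c ℚ.* x ∣        ≡⟨ ℚₚ.∣p*q∣≡∣p∣*∣q∣ c x ⟩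
    ℚ.∣ c ∣ ℚ.* ℚ.∣ x ∣  ≤⟨ ℚₚ.*-monoʳ-≤-nonNeg ℚ.∣ x ∣ {{ℚₚ.∣-∣-nonNeg x}} c≤K ⟩
    K ℚ.* ℚ.∣ x ∣        <⟨ ℚₚ.*-monoʳ-<-pos K x<δ ⟩
    K ℚ.* (ε ℚ.* ℚ.1/ K) ≡⟨ solve 3 (λ K ε i → K :* (ε :* i) := ε :* (K :* i)) refl K ε (ℚ.1/ K) ⟩
    ε ℚ.* (K ℚ.* ℚ.1/ K) ≡⟨ cong (ε ℚ.*_) (ℚₚ.*-inverseʳ K) ⟩
    ε ℚ.* 1ℚ             ≡⟨ ℚₚ.*-identityʳ ε ⟩
    ε                    ∎
    where
    open ℚₚ.≤-Reasoning
    open +-*-Solver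
    c≤K : ℚ.∣ c ∣ ℚ.≤ K
    c≤K = subst (ℚ._≤ K) (ℚₚ.+-identityʳ ℚ.∣ c ∣) (ℚₚ.+-monoʳ-≤ ℚ.∣ c ∣ 0≤1)

Null-cong : ∀ {f g} → (∀ n → f n ≡ g n) → Null f → Null g
Null-cong f≗g f→0 ε 0<ε =
  Eventually-map (λ n → subst (λ q → ℚ.∣ q ∣ ℚ.< ε) (f≗g n)) (f→0 ε 0<ε)

Null-*ˡ : ∀ {f} c → Null f → Null (λ n → c ℚ.* f n)
Null-*ˡ {f} c f→0 ε 0<ε =
  let δ , 0<δ , bound = ∣∣-bound-* c ε 0<ε
  in Eventually-map (λ n → bound (f n)) (f→0 δ 0<δ)

Null-+ : ∀ {f g} → Null f → Null g → Null (λ n → f n ℚ.+ g n)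
Null-+ {f} {g} f→0 g→0 ε 0<ε =
  Eventually-map
    (λ n (f<η , g<η) → ℚₚ.≤-<-trans (ℚₚ.∣p+q∣≤∣p∣+∣q∣ (f n) (g n))
                         (subst (ℚ.∣ f n ∣ ℚ.+ ℚ.∣ g n ∣ ℚ.<_) η+η≡ε (ℚₚ.+-mono-< f<η g<η)))
    (Eventually-× (f→0 η 0<η) (g→0 η 0<η))
  where
  η : ℚ
  η = ½ ℚ.* ε
  0<η : 0ℚ ℚ.< η
  0<η = *-pos (ℚₚ.positive⁻¹ ½) 0<ε
  η+η≡ε : η ℚ.+ η ≡ ε
  η+η≡ε = trans (sym (ℚₚ.*-distribʳ-+ ε ½ ½)) (ℚₚ.*-identityˡ ε)

Null-0 : Null (λ _ → 0ℚ)
Null-0 ε 0<ε = 0 , λ _ _ → 0<ε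

¬Null-positive : ∀ {f δ} → 0ℚ ℚ.< δ → Eventually (λ n → δ ℚ.≤ f n) → ¬ Null f
¬Null-positive {f} {δ} 0<δ δ≤f f→0 =
  let N , both = Eventually-× δ≤f (f→0 δ 0<δ)
      δ≤fN , fN<δ = both N ℕₚ.≤-refl
      ∣fN∣≡fN = ℚₚ.0≤p⇒∣p∣≡p (ℚₚ.≤-trans (ℚₚ.<⇒≤ 0<δ) δ≤fN)
  in ℚₚ.<-irrefl refl (ℚₚ.≤-<-trans δ≤fN (subst (ℚ._< δ) ∣fN∣≡fN fN<δ))

Null-const : ∀ q → Null (λ _ → q) → q ≡ 0ℚ
Null-const q q→0 with ℚ.∣ q ∣ ℚₚ.≟ 0ℚ
... | yes ∣q∣≡0 = ℚₚ.∣p∣≡0⇒p≡0 q ∣q∣≡0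
... | no  ∣q∣≢0 =
  let N , q<q = q→0 ℚ.∣ q ∣ (ℚₚ.positive⁻¹ _
        {{ℚₚ.nonNeg∧nonZero⇒pos ℚ.∣ q ∣ {{ℚₚ.∣-∣-nonNeg q}} {{ℚ.≢-nonZero ∣q∣≢0}}}})
  in ⊥-elim (ℚₚ.<-irrefl refl (q<q N ℕₚ.≤-refl))

Null-cancel : ∀ {f} c → c ≢ 0ℚ → Null (λ n → c ℚ.* f n) → Null f
Null-cancel {f} c c≢0 cf→0 = Null-cong cancel (Null-*ˡ (ℚ.1/ c) cf→0)
  where
  instance
    c-nonZero : ℚ.NonZero c
    c-nonZero = ℚ.≢-nonZero c≢0
  cancel : ∀ n → ℚ.1/ c ℚ.* (c ℚ.* f n) ≡ f n
  cancel n = trans (sym (ℚₚ.*-assoc (ℚ.1/ c) c (f n)))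
                   (trans (cong (ℚ._* f n) (ℚₚ.*-inverseˡ c)) (ℚₚ.*-identityˡ (f n)))

-- Affine paths and chords of the parabola

affine : ℚ → ℚ → ℝ → ℝ
affine p c x .approx n = p ℚ.+ c ℚ.* approx x n
affine p c x .cauchy ε 0<ε =
  let δ , 0<δ , bound = ∣∣-bound-* c ε 0<ε
      N , close = cauchy x δ 0<δ
  in N , λ m n N≤m N≤n → subst (λ q → ℚ.∣ q ∣ ℚ.< ε)
        (solve 4 (λ p c x y → c :* (x :- y) := (p :+ c :* x) :- (p :+ c :* y)) refl
           p c (approx x m) (approx x n))
        (bound _ (close m n N≤m N≤n))
  where open +-*-Solver

affine-near : ∀ p c ε → 0ℚ ℚ.< ε →
              ∃[ δ ] 0ℚ ℚ.< δ × (∀ x y → Near δ x y → Near ε (affine p c x) (affine p c y))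
affine-near p c ε 0<ε =
  let δ , 0<δ , bound = ∣∣-bound-* c ε 0<ε
  in δ , 0<δ , λ x y → Eventually-map λ n close → subst (λ q → ℚ.∣ q ∣ ℚ.< ε)
        (solve 4 (λ p c x y → c :* (x :- y) := (p :+ c :* x) :- (p :+ c :* y)) refl
           p c (approx x n) (approx y n))
        (bound _ close)
  where open +-*-Solver

commonPositive : ∀ {δ η} → 0ℚ ℚ.< δ → 0ℚ ℚ.< η → ∃[ ζ ] 0ℚ ℚ.< ζ × ζ ℚ.≤ δ × ζ ℚ.≤ η
commonPositive {δ} {η} 0<δ 0<η with ℚₚ.≤-total δ η
... | inj₁ δ≤η = δ , 0<δ , ℚₚ.≤-refl , δ≤η
... | inj₂ η≤δ = η , 0<η , η≤δ , ℚₚ.≤-refl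

Near-weaken : ∀ {δ η} x y → δ ℚ.≤ η → Near δ x y → Near η x y
Near-weaken x y δ≤η = Eventually-map λ n close → ℚₚ.<-≤-trans close δ≤η

onParabola : ℚ → Point
onParabola a = point (fromℚ a) (fromℚ (a ℚ.* a))

chordAt : ℚ → ℚ → UnitInterval → Point
chordAt a b t = point (affine a (b ℚ.- a) (value t))
                      (affine (a ℚ.* a) (b ℚ.* b ℚ.- a ℚ.* a) (value t))

chord : ∀ a b → a ℚ.< b → Arc (onParabola a) (onParabola b)
chord a b a<b = record
  { at = chordAt a b
  ; continuous = cont
  -- The first coordinates alone determine the parameter, their slope `b - a` being nonzero.
  ; injective = λ s t (x≈ , _) → Null-cancel (b ℚ.- a) b-a≢0
      (Null-cong (λ n → difference a (b ℚ.- a) (approx (value s) n) (approx (value t) n)) x≈)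
  ; start = Null-cong (λ _ → sym (base a (b ℚ.- a))) Null-0
          , Null-cong (λ _ → sym (base (a ℚ.* a) (b ℚ.* b ℚ.- a ℚ.* a))) Null-0
  ; end = Null-cong (λ _ → sym (tip a b)) Null-0
        , Null-cong (λ _ → sym (tip (a ℚ.* a) (b ℚ.* b))) Null-0
  }
  where
  open +-*-Solver
  b-a≢0 : b ℚ.- a ≢ 0ℚ
  b-a≢0 eq = ℚₚ.<⇒≢ a<b (sym (p-q≡0⇒p≡q b a eq))
  difference : ∀ a c s t → (a ℚ.+ c ℚ.* s) ℚ.- (a ℚ.+ c ℚ.* t) ≡ c ℚ.* (s ℚ.- t)
  difference = solve 4 (λ a c s t → (a :+ c :* s) :- (a :+ c :* t) := c :* (s :- t)) refl
  base : ∀ p c → (p ℚ.+ c ℚ.* 0ℚ) ℚ.- p ≡ 0ℚ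
  base = solve 2 (λ p c → (p :+ c :* con 0ℚ) :- p := con 0ℚ) refl
  tip : ∀ p q → (p ℚ.+ (q ℚ.- p) ℚ.* 1ℚ) ℚ.- q ≡ 0ℚ
  tip = solve 2 (λ p q → (p :+ (q :- p) :* con 1ℚ) :- q := con 0ℚ) refl
  cont : ∀ s ε → 0ℚ ℚ.< ε → ∃[ δ ] 0ℚ ℚ.< δ ×
         (∀ t → Near δ (value s) (value t) → Nearᴾ ε (chordAt a b s) (chordAt a b t))
  cont s ε 0<ε =
    let δ , 0<δ , nearˣ = affine-near a (b ℚ.- a) ε 0<ε
        η , 0<η , nearʸ = affine-near (a ℚ.* a) (b ℚ.* b ℚ.- a ℚ.* a) ε 0<ε
        ζ , 0<ζ , ζ≤δ , ζ≤η = commonPositive 0<δ 0<η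
    in ζ , 0<ζ , λ t close →
         nearˣ (value s) (value t) (Near-weaken (value s) (value t) ζ≤δ close) ,
         nearʸ (value s) (value t) (Near-weaken (value s) (value t) ζ≤η close)

-- The value at the point (c , c²) of y - (a + b) x + a b, which vanishes on the
-- chord from (a , a²) to (b , b²).
side : ℚ → ℚ → ℚ → ℚ
side a b c = (c ℚ.- a) ℚ.* (c ℚ.- b)

interpolate : ℚ → ℚ → UnitInterval → ℕ → ℚ
interpolate P Q t n = (1ℚ ℚ.- approx (value t) n) ℚ.* P ℚ.+ approx (value t) n ℚ.* Q

-- The left side is the value of the linear form of `side` at the point `t` of the second chord
-- minus its value at the point `s` of the first. The latter value is 0, so `s` drops out, and along
-- the second chord the form interpolates its values at the ends. At a common point the left side is
-- a null sequence, being a fixed combination of coordinate differences.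
side-identity : ∀ a b a′ b′ s t →
  ℚ.- 1ℚ ℚ.* ((a ℚ.* a ℚ.+ (b ℚ.* b ℚ.- a ℚ.* a) ℚ.* s) ℚ.-
              (a′ ℚ.* a′ ℚ.+ (b′ ℚ.* b′ ℚ.- a′ ℚ.* a′) ℚ.* t)) ℚ.+
  (a ℚ.+ b) ℚ.* ((a ℚ.+ (b ℚ.- a) ℚ.* s) ℚ.- (a′ ℚ.+ (b′ ℚ.- a′) ℚ.* t)) ≡
  (1ℚ ℚ.- t) ℚ.* side a b a′ ℚ.+ t ℚ.* side a b b′
side-identity = solve 6 (λ a b a′ b′ s t →
    con (ℚ.- 1ℚ) :* ((a :* a :+ (b :* b :- a :* a) :* s) :-
                     (a′ :* a′ :+ (b′ :* b′ :- a′ :* a′) :* t)) :+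
    (a :+ b) :* ((a :+ (b :- a) :* s) :- (a′ :+ (b′ :- a′) :* t)) :=
    (con 1ℚ :- t) :* ((a′ :- a) :* (a′ :- b)) :+ t :* ((b′ :- a) :* (b′ :- b)))
  refl
  where open +-*-Solver

side-identity₁ : ∀ a b c s →
  ℚ.- 1ℚ ℚ.* ((a ℚ.* a ℚ.+ (b ℚ.* b ℚ.- a ℚ.* a) ℚ.* s) ℚ.- c ℚ.* c) ℚ.+
  (a ℚ.+ b) ℚ.* ((a ℚ.+ (b ℚ.- a) ℚ.* s) ℚ.- c) ≡ side a b c
side-identity₁ = solve 4 (λ a b c s →
    con (ℚ.- 1ℚ) :* ((a :* a :+ (b :* b :- a :* a) :* s) :- c :* c) :+
    (a :+ b) :* ((a :+ (b :- a) :* s) :- c) := (c :- a) :* (c :- b))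
  refl
  where open +-*-Solver

meet⇒Null : ∀ a b a′ b′ s t → chordAt a b s ≈ᴾ chordAt a′ b′ t →
            Null (interpolate (side a b a′) (side a b b′) t)
meet⇒Null a b a′ b′ s t (x≈ , y≈) = Null-cong
  (λ n → side-identity a b a′ b′ (approx (value s) n) (approx (value t) n))
  (Null-+ (Null-*ˡ (ℚ.- 1ℚ) y≈) (Null-*ˡ (a ℚ.+ b) x≈))

through⇒side≡0 : ∀ a b c s → chordAt a b s ≈ᴾ onParabola c → side a b c ≡ 0ℚ
through⇒side≡0 a b c s (x≈ , y≈) = Null-const _ (Null-cong
  (λ n → side-identity₁ a b c (approx (value s) n))
  (Null-+ (Null-*ˡ (ℚ.- 1ℚ) y≈) (Null-*ˡ (a ℚ.+ b) x≈)))

-- A strict inequality of reals carries a rational gap that eventually separates the approximations;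
-- the smaller of the two gaps serves both ends.
Interior⇒bounds : ∀ t → Interior t → ∃[ ε ] 0ℚ ℚ.< ε ×
  Eventually (λ n → ε ℚ.≤ approx (value t) n × ε ℚ.≤ 1ℚ ℚ.- approx (value t) n)
Interior⇒bounds t ((δ , 0<δ , δ<t) , (η , 0<η , t<1-η)) =
  let ε , 0<ε , ε≤δ , ε≤η = commonPositive 0<δ 0<η
  in ε , 0<ε , Eventually-map
       (λ n (l , r) → ℚₚ.≤-trans ε≤δ (low n l) , ℚₚ.≤-trans ε≤η (high n r))
       (Eventually-× δ<t t<1-η)
  where
  open +-*-Solver
  low : ∀ n → 0ℚ ℚ.+ δ ℚ.< approx (value t) n → δ ℚ.≤ approx (value t) n
  low n l = ℚₚ.<⇒≤ (subst (ℚ._< _) (ℚₚ.+-identityˡ δ) l)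
  move : ∀ x y → x ℚ.+ y ℚ.- x ≡ y
  move = solve 2 (λ x y → x :+ y :- x := y) refl
  high : ∀ n → approx (value t) n ℚ.+ η ℚ.< 1ℚ → η ℚ.≤ 1ℚ ℚ.- approx (value t) n
  high n r = subst (ℚ._≤ _) (move (approx (value t) n) η)
    (ℚₚ.+-monoˡ-≤ (ℚ.- approx (value t) n) (ℚₚ.<⇒≤ r))

-- Both weights eventually stay above some positive `ε`, so the interpolated values stay above
-- `ε (P + Q)`.
¬Null-interpolate : ∀ {P Q} t → Interior t → 0ℚ ℚ.≤ P → 0ℚ ℚ.≤ Q → 0ℚ ℚ.< P ℚ.+ Q →
                    ¬ Null (interpolate P Q t)
¬Null-interpolate {P} {Q} t t-inner 0≤P 0≤Q 0<P+Q =
  let ε , 0<ε , bounds = Interior⇒bounds t t-inner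
  in ¬Null-positive (*-pos 0<ε 0<P+Q) (Eventually-map
       (λ n (l , r) → subst (ℚ._≤ interpolate P Q t n) (sym (ℚₚ.*-distribˡ-+ ε P Q))
          (ℚₚ.+-mono-≤ (ℚₚ.*-monoʳ-≤-nonNeg P {{ℚ.nonNegative 0≤P}} r)
                       (ℚₚ.*-monoʳ-≤-nonNeg Q {{ℚ.nonNegative 0≤Q}} l)))
       bounds)

Null-interpolate-neg : ∀ {P Q} t → Null (interpolate P Q t) → Null (interpolate (ℚ.- P) (ℚ.- Q) t)
Null-interpolate-neg {P} {Q} t f→0 =
  Null-cong (λ n → negate P Q (approx (value t) n)) (Null-*ˡ (ℚ.- 1ℚ) f→0)
  where
  open +-*-Solver
  negate : ∀ P Q t → ℚ.- 1ℚ ℚ.* ((1ℚ ℚ.- t) ℚ.* P ℚ.+ t ℚ.* Q) ≡ (1ℚ ℚ.- t) ℚ.* ℚ.- P ℚ.+ t ℚ.* ℚ.- Q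
  negate = solve 3 (λ P Q t → con (ℚ.- 1ℚ) :* ((con 1ℚ :- t) :* P :+ t :* Q) :=
                              (con 1ℚ :- t) :* :- P :+ t :* :- Q) refl

-- The difference of the two interpolations is `(P - Q) (s - t)`, and the constant factor can be
-- cancelled.
Null-interpolate-unique : ∀ {P Q} s t → P ≢ Q → Null (interpolate P Q s) → Null (interpolate P Q t) →
                          value s ≈ value t
Null-interpolate-unique {P} {Q} s t P≢Q f→0 g→0 = Null-cancel (P ℚ.- Q) (P≢Q ∘ p-q≡0⇒p≡q P Q)
  (Null-cong (λ n → gap P Q (approx (value s) n) (approx (value t) n))
    (Null-+ g→0 (Null-*ˡ (ℚ.- 1ℚ) f→0)))
  where
  open +-*-Solver
  gap : ∀ P Q s t → (1ℚ ℚ.- t) ℚ.* P ℚ.+ t ℚ.* Q ℚ.+ ℚ.- 1ℚ ℚ.* ((1ℚ ℚ.- s) ℚ.* P ℚ.+ s ℚ.* Q) ≡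
            (P ℚ.- Q) ℚ.* (s ℚ.- t)
  gap = solve 4 (λ P Q s t →
    (con 1ℚ :- t) :* P :+ t :* Q :+ con (ℚ.- 1ℚ) :* ((con 1ℚ :- s) :* P :+ s :* Q) :=
    (P :- Q) :* (s :- t)) refl

-- Straight drawings on the parabola

abscissa : ℕ → ℚ
abscissa 0       = 0ℚ
abscissa (suc m) = abscissa m ℚ.+ 1ℚ

abscissa-step : ∀ m → abscissa m ℚ.< abscissa (suc m)
abscissa-step m = subst (ℚ._< abscissa (suc m)) (ℚₚ.+-identityʳ (abscissa m))
  (ℚₚ.+-monoʳ-< (abscissa m) (ℚₚ.positive⁻¹ 1ℚ))

abscissa-mono-<′ : ∀ {m n} → m ℕ.<′ n → abscissa m ℚ.< abscissa n
abscissa-mono-<′ {m} ℕ.≤′-refl                = abscissa-step m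
abscissa-mono-<′     (ℕ.≤′-step {n = n} m<n) = ℚₚ.<-trans (abscissa-mono-<′ m<n) (abscissa-step n)

abscissa-mono-< : ∀ {m n} → m ℕ.< n → abscissa m ℚ.< abscissa n
abscissa-mono-< = abscissa-mono-<′ ∘ ℕₚ.<⇒<′

abscissa-mono-≤ : ∀ {m n} → m ℕ.≤ n → abscissa m ℚ.≤ abscissa n
abscissa-mono-≤ m≤n with ℕₚ.m≤n⇒m<n∨m≡n m≤n
... | inj₁ m<n  = ℚₚ.<⇒≤ (abscissa-mono-< m<n)
... | inj₂ refl = ℚₚ.≤-refl

abscissa-injective : ∀ {m n} → abscissa m ≡ abscissa n → m ≡ n
abscissa-injective {m} {n} eq with ℕₚ.<-cmp m n
... | tri< m<n _ _ = ⊥-elim (ℚₚ.<⇒≢ (abscissa-mono-< m<n) eq)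
... | tri≈ _ m≡n _ = m≡n
... | tri> _ _ n<m = ⊥-elim (ℚₚ.<⇒≢ (abscissa-mono-< n<m) (sym eq))

≢0⇒0< : ∀ {p} → 0ℚ ℚ.≤ p → p ≢ 0ℚ → 0ℚ ℚ.< p
≢0⇒0< {p} 0≤p p≢0 = ℚₚ.positive⁻¹ p
  {{ℚₚ.nonNeg∧nonZero⇒pos p {{ℚ.nonNegative 0≤p}} {{ℚ.≢-nonZero p≢0}}}}

sum-positive : ∀ {p q} → 0ℚ ℚ.≤ p → 0ℚ ℚ.≤ q → ¬ (p ≡ 0ℚ × q ≡ 0ℚ) → 0ℚ ℚ.< p ℚ.+ q
sum-positive {p} {q} 0≤p 0≤q nz with p ℚₚ.≟ 0ℚ
... | yes refl = subst (0ℚ ℚ.<_) (sym (ℚₚ.+-identityˡ q)) (≢0⇒0< 0≤q λ q≡0 → nz (refl , q≡0))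
... | no  p≢0  = ℚₚ.<-≤-trans (≢0⇒0< 0≤p p≢0)
  (subst (ℚ._≤ p ℚ.+ q) (ℚₚ.+-identityʳ p) (ℚₚ.+-monoʳ-≤ p 0≤q))

neg-0 : ∀ {p} → ℚ.- p ≡ 0ℚ → p ≡ 0ℚ
neg-0 {p} eq = trans (solve 1 (λ p → p := :- (:- p)) refl p) (cong ℚ.-_ eq)
  where open +-*-Solver

side≡0⇒end : ∀ a b c → side a b c ≡ 0ℚ → c ≡ a ⊎ c ≡ b
side≡0⇒end a b c eq with c ℚₚ.≟ a
... | yes c≡a = inj₁ c≡a
... | no  c≢a = inj₂ (p-q≡0⇒p≡q c b (*-cancel-0 (c ℚ.- a) (c≢a ∘ p-q≡0⇒p≡q c a) eq))

-- The first coordinate exceeds `a` by `t (b - a)`, an interpolation from 0 to `b - a`, which stays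
-- away from 0 at interior parameters.
chordAt-start : ∀ a b t → a ℚ.< b → Interior t → ¬ chordAt a b t ≈ᴾ onParabola a
chordAt-start a b t a<b t-inner (x≈ , _) =
  ¬Null-interpolate t t-inner ℚₚ.≤-refl (ℚₚ.<⇒≤ 0<b-a)
    (subst (0ℚ ℚ.<_) (sym (ℚₚ.+-identityˡ (b ℚ.- a))) 0<b-a)
    (Null-cong (λ n → eq a b (approx (value t) n)) x≈)
  where
  0<b-a : 0ℚ ℚ.< b ℚ.- a
  0<b-a = p<q⇒0<q-p a<b
  open +-*-Solver
  eq : ∀ a b t → (a ℚ.+ (b ℚ.- a) ℚ.* t) ℚ.- a ≡ (1ℚ ℚ.- t) ℚ.* 0ℚ ℚ.+ t ℚ.* (b ℚ.- a)
  eq = solve 3 (λ a b t → (a :+ (b :- a) :* t) :- a := (con 1ℚ :- t) :* con 0ℚ :+ t :* (b :- a)) refl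

chordAt-end : ∀ a b t → a ℚ.< b → Interior t → ¬ chordAt a b t ≈ᴾ onParabola b
chordAt-end a b t a<b t-inner (x≈ , _) =
  ¬Null-interpolate t t-inner (ℚₚ.<⇒≤ 0<b-a) ℚₚ.≤-refl
    (subst (0ℚ ℚ.<_) (sym (ℚₚ.+-identityʳ (b ℚ.- a))) 0<b-a)
    (Null-cong (λ n → eq a b (approx (value t) n)) (Null-*ˡ (ℚ.- 1ℚ) x≈))
  where
  0<b-a : 0ℚ ℚ.< b ℚ.- a
  0<b-a = p<q⇒0<q-p a<b
  open +-*-Solver
  eq : ∀ a b t → ℚ.- 1ℚ ℚ.* ((a ℚ.+ (b ℚ.- a) ℚ.* t) ℚ.- b) ≡ (1ℚ ℚ.- t) ℚ.* (b ℚ.- a) ℚ.+ t ℚ.* 0ℚ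
  eq = solve 3 (λ a b t → con (ℚ.- 1ℚ) :* ((a :+ (b :- a) :* t) :- b) :=
                          (con 1ℚ :- t) :* (b :- a) :+ t :* con 0ℚ) refl

≈ᴾ-sym : ∀ {p q} → p ≈ᴾ q → q ≈ᴾ p
≈ᴾ-sym {p} {q} (x≈ , y≈) = flip (x-coord p) (x-coord q) x≈ , flip (y-coord p) (y-coord q) y≈
  where
  open +-*-Solver
  negate : ∀ u v → ℚ.- 1ℚ ℚ.* (u ℚ.- v) ≡ v ℚ.- u
  negate = solve 2 (λ u v → con (ℚ.- 1ℚ) :* (u :- v) := v :- u) refl
  flip : ∀ x y → x ≈ y → y ≈ x
  flip x y x≈y = Null-cong (λ n → negate (approx x n) (approx y n)) (Null-*ˡ (ℚ.- 1ℚ) x≈y)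

Inside Outside : ℕ → ℕ → ℕ → Set
Inside  x y z = x ℕ.≤ z × z ℕ.≤ y
Outside x y z = z ℕ.≤ x ⊎ y ℕ.≤ z

-- `Inside` and `Outside` are closed conditions: `x` and `y` satisfy both, so chords with a common
-- end need no separate treatment.
SameSide : ℕ → ℕ → ℕ → ℕ → Set
SameSide x y u v = (Inside x y u × Inside x y v) ⊎ (Outside x y u × Outside x y v)

vertexSide : ℕ → ℕ → ℕ → ℚ
vertexSide x y z = side (abscissa x) (abscissa y) (abscissa z)

Inside⇒side : ∀ x y z → Inside x y z → 0ℚ ℚ.≤ ℚ.- vertexSide x y z
Inside⇒side x y z (x≤z , z≤y) = subst (0ℚ ℚ.≤_) (eq (abscissa x) (abscissa y) (abscissa z))
  (*-nonNeg (p≤q⇒0≤q-p (abscissa-mono-≤ x≤z)) (p≤q⇒0≤q-p (abscissa-mono-≤ z≤y)))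
  where
  open +-*-Solver
  eq : ∀ a b c → (c ℚ.- a) ℚ.* (b ℚ.- c) ≡ ℚ.- ((c ℚ.- a) ℚ.* (c ℚ.- b))
  eq = solve 3 (λ a b c → (c :- a) :* (b :- c) := :- ((c :- a) :* (c :- b))) refl

Outside⇒side : ∀ x y z → x ℕ.≤ y → Outside x y z → 0ℚ ℚ.≤ vertexSide x y z
Outside⇒side x y z x≤y (inj₁ z≤x) = subst (0ℚ ℚ.≤_) (eq (abscissa x) (abscissa y) (abscissa z))
  (*-nonNeg (p≤q⇒0≤q-p (abscissa-mono-≤ z≤x)) (p≤q⇒0≤q-p (abscissa-mono-≤ (ℕₚ.≤-trans z≤x x≤y))))
  where
  open +-*-Solver
  eq : ∀ a b c → (a ℚ.- c) ℚ.* (b ℚ.- c) ≡ (c ℚ.- a) ℚ.* (c ℚ.- b)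
  eq = solve 3 (λ a b c → (a :- c) :* (b :- c) := (c :- a) :* (c :- b)) refl
Outside⇒side x y z x≤y (inj₂ y≤z) =
  *-nonNeg (p≤q⇒0≤q-p (abscissa-mono-≤ (ℕₚ.≤-trans x≤y y≤z))) (p≤q⇒0≤q-p (abscissa-mono-≤ y≤z))

vertexSide≡0⇒end : ∀ x y z → vertexSide x y z ≡ 0ℚ → z ≡ x ⊎ z ≡ y
vertexSide≡0⇒end x y z eq with side≡0⇒end (abscissa x) (abscissa y) (abscissa z) eq
... | inj₁ e = inj₁ (abscissa-injective e)
... | inj₂ e = inj₂ (abscissa-injective e)

both-ends : ∀ {x y u v} → x ℕ.< y → u ℕ.< v → u ≡ x ⊎ u ≡ y → v ≡ x ⊎ v ≡ y → u ≡ x × v ≡ y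
both-ends x<y u<v (inj₁ refl) (inj₁ refl) = ⊥-elim (ℕₚ.<-irrefl refl u<v)
both-ends x<y u<v (inj₁ refl) (inj₂ refl) = refl , refl
both-ends x<y u<v (inj₂ refl) (inj₁ refl) = ⊥-elim (ℕₚ.<-asym x<y u<v)
both-ends x<y u<v (inj₂ refl) (inj₂ refl) = ⊥-elim (ℕₚ.<-irrefl refl u<v)

sides≢0 : ∀ {x y u v} → x ℕ.< y → u ℕ.< v → ¬ (u ≡ x × v ≡ y) →
          ¬ (vertexSide x y u ≡ 0ℚ × vertexSide x y v ≡ 0ℚ)
sides≢0 {x} {y} {u} {v} x<y u<v differ (u≡0 , v≡0) =
  differ (both-ends x<y u<v (vertexSide≡0⇒end x y u u≡0) (vertexSide≡0⇒end x y v v≡0))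

vertexChord : ℕ → ℕ → UnitInterval → Point
vertexChord x y = chordAt (abscissa x) (abscissa y)

-- Along the chord from `u` to `v` the linear form of the chord `x y` interpolates two values of the
-- same sign. They are not both 0, since the line meets the parabola only at `x` and `y`; hence the
-- form does not vanish at an interior parameter.
SameSide⇒¬meet : ∀ {x y u v} → x ℕ.< y → u ℕ.< v → ¬ (u ≡ x × v ≡ y) → SameSide x y u v →
                 ∀ s t → Interior t → ¬ vertexChord x y s ≈ᴾ vertexChord u v t
SameSide⇒¬meet {x} {y} {u} {v} x<y u<v differ same s t t-inner meet = case same
  where
  null : Null (interpolate (vertexSide x y u) (vertexSide x y v) t)
  null = meet⇒Null (abscissa x) (abscissa y) (abscissa u) (abscissa v) s t meet
  case : SameSide x y u v → ⊥
  -- Between `x` and `y` the parabola runs below the chord, so the values are negated first.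
  case (inj₁ (iu , iv)) = ¬Null-interpolate t t-inner (Inside⇒side x y u iu) (Inside⇒side x y v iv)
    (sum-positive (Inside⇒side x y u iu) (Inside⇒side x y v iv)
      λ (p , q) → sides≢0 {x} {y} {u} {v} x<y u<v differ (neg-0 p , neg-0 q))
    (Null-interpolate-neg t null)
  case (inj₂ (ou , ov)) = ¬Null-interpolate t t-inner
    (Outside⇒side x y u (ℕₚ.<⇒≤ x<y) ou) (Outside⇒side x y v (ℕₚ.<⇒≤ x<y) ov)
    (sum-positive (Outside⇒side x y u (ℕₚ.<⇒≤ x<y) ou) (Outside⇒side x y v (ℕₚ.<⇒≤ x<y) ov)
      (sides≢0 {x} {y} {u} {v} x<y u<v differ))
    null

-- Here the roles are exchanged: the form of the chord `u v` is interpolated along `x y`, and its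
-- zero determines the parameter `s` on `x y`.
meet-unique : ∀ {x y u v} → x ℕ.< y → u ℕ.< v → ¬ (u ≡ x × v ≡ y) → ∀ s t s′ t′ →
              vertexChord x y s ≈ᴾ vertexChord u v t → vertexChord x y s′ ≈ᴾ vertexChord u v t′ →
              value s ≈ value s′
meet-unique {x} {y} {u} {v} x<y u<v differ s t s′ t′ meet meet′ =
  Null-interpolate-unique s s′ P≢Q (null s t meet) (null s′ t′ meet′)
  where
  P Q : ℚ
  P = vertexSide u v x
  Q = vertexSide u v y
  null : ∀ s t → vertexChord x y s ≈ᴾ vertexChord u v t → Null (interpolate P Q s)
  null s t m = meet⇒Null (abscissa u) (abscissa v) (abscissa x) (abscissa y) t s
    (≈ᴾ-sym {vertexChord x y s} {vertexChord u v t} m)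
  open +-*-Solver
  constant : ∀ P Q s → P ≡ Q → (1ℚ ℚ.- s) ℚ.* P ℚ.+ s ℚ.* Q ≡ P
  constant P .P s refl = solve 2 (λ P s → (con 1ℚ :- s) :* P :+ s :* P := P) refl P s
  -- If both ends lay at the same height over the other line, then the height at
  -- the meeting point shows that this height is 0.
  P≢Q : P ≢ Q
  P≢Q P≡Q = sides≢0 {u} {v} {x} {y} u<v x<y (λ (p , q) → differ (sym p , sym q))
    (P≡0 , trans (sym P≡Q) P≡0)
    where
    P≡0 : P ≡ 0ℚ
    P≡0 = Null-const P (Null-cong (λ n → constant P Q (approx (value s) n) P≡Q) (null s t meet))

module Parabola {n : ℕ} (G : Graph n) where
  open Edge

  Edge-≡ : {e f : Edge G} → tail e ≡ tail f → head e ≡ head f → e ≡ f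
  Edge-≡ {record { tail<head = p ; joined = i }} {record { tail<head = q ; joined = j }} refl refl
    rewrite ℕₚ.<-irrelevant p q | T-irrelevant i j = refl

  position : Fin n → Point
  position v = onParabola (abscissa (toℕ v))

  drawing : Drawing G
  drawing = record
    { position       = position
    ; distinct       = λ u v (x≈ , _) → Finₚ.toℕ-injective (abscissa-injective
                         (p-q≡0⇒p≡q (abscissa (toℕ u)) (abscissa (toℕ v)) (Null-const _ x≈)))
    ; arc            = λ e → chord _ _ (abscissa-mono-< (tail<head e))
    ; avoidsVertices = avoids
    }
    where
    avoids : ∀ e t → Interior t → ∀ v →
             ¬ vertexChord (toℕ (tail e)) (toℕ (head e)) t ≈ᴾ position v
    avoids e t t-inner v through = case (vertexSide≡0⇒end x y z
        (through⇒side≡0 (abscissa x) (abscissa y) (abscissa z) t through))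
      where
      x y z : ℕ
      x = toℕ (tail e)
      y = toℕ (head e)
      z = toℕ v
      moved : ∀ {w} → z ≡ w → vertexChord x y t ≈ᴾ onParabola (abscissa w)
      moved z≡w = subst (λ w → vertexChord x y t ≈ᴾ onParabola (abscissa w)) z≡w through
      case : z ≡ x ⊎ z ≡ y → ⊥
      case (inj₁ z≡x) = chordAt-start (abscissa x) (abscissa y) t
        (abscissa-mono-< (tail<head e)) t-inner (moved z≡x)
      case (inj₂ z≡y) = chordAt-end (abscissa x) (abscissa y) t
        (abscissa-mono-< (tail<head e)) t-inner (moved z≡y)

  open Drawing drawing using (Crossing; SameCrossing)

  edgeSameSide : Edge G → Edge G → Set
  edgeSameSide e f = SameSide (toℕ (tail e)) (toℕ (head e)) (toℕ (tail f)) (toℕ (head f))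

  ends-differ : ∀ {e f : Edge G} → f ≢ e → ¬ (toℕ (tail f) ≡ toℕ (tail e) × toℕ (head f) ≡ toℕ (head e))
  ends-differ f≢e (p , q) = f≢e (Edge-≡ (Finₚ.toℕ-injective p) (Finₚ.toℕ-injective q))

  crossing⇒¬sameSide : ∀ {e} (c : Crossing e) → ¬ edgeSameSide e (Crossing.other c)
  crossing⇒¬sameSide {e} c same =
    SameSide⇒¬meet (tail<head e) (tail<head other) (ends-differ other≢e) same s t t-inner meet
    where open Crossing c

  -- Both versions are needed: of two nested arcs either may be the outer one, and `SameSide` is
  -- obtained for the chord of the outer arc.
  crossing⇒¬sameSide′ : ∀ {e} (c : Crossing e) → ¬ edgeSameSide (Crossing.other c) e
  crossing⇒¬sameSide′ {e} c same =
    SameSide⇒¬meet (tail<head other) (tail<head e) (ends-differ (other≢e ∘ sym)) same t s s-inner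
      (≈ᴾ-sym {vertexChord (toℕ (tail e)) (toℕ (head e)) s}
              {vertexChord (toℕ (tail other)) (toℕ (head other)) t} meet)
    where open Crossing c

  -- Straight edges meet at most once, so crossings on `e` can be counted by the other edge.
  sameOther⇒SameCrossing : ∀ {e} (c d : Crossing e) → Crossing.other c ≡ Crossing.other d →
                           SameCrossing c d
  sameOther⇒SameCrossing {e} c d eq = eq ,
    meet-unique (tail<head e) (tail<head (Crossing.other c)) (ends-differ (Crossing.other≢e c))
      (Crossing.s c) (Crossing.t c) (Crossing.s d) (Crossing.t d) (Crossing.meet c)
      (subst (λ f → vertexChord (toℕ (tail e)) (toℕ (head e)) (Crossing.s d) ≈ᴾ
                    vertexChord (toℕ (tail f)) (toℕ (head f)) (Crossing.t d))
             (sym eq) (Crossing.meet d))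

-- Chords of the cyclic order modulo n

-- With `S = a + b` and `S′ = a′ + b′`, the difference `t - t′` is `(S′ - S) - 2 (b′ - b)`. The
-- companion `spans-close′` rests on `t′ - t` being `(S′ - S) - 2 (a′ - a)`.
spans-close : ∀ {a b t a′ b′ t′ D} → a + t ≡ b → a′ + t′ ≡ b′ → b ℕ.< b′ →
              a′ + b′ ℕ.< a + b + D → t ℕ.< t′ + D
spans-close {a} {_} {t} {a′} {_} {t′} {D} refl refl b<b′ S′<S+D =
  ℕₚ.+-cancelˡ-< (a + a′ + (a′ + t′)) _ _ (begin-strict
    a + a′ + (a′ + t′) + t          ≡⟨ regroup a a′ t t′ ⟩
    a′ + (a′ + t′) + (a + t)        <⟨ ℕₚ.+-mono-< S′<S+D b<b′ ⟩
    a + (a + t) + D + (a′ + t′)     ≡⟨ regroup′ a t D (a′ + t′) ⟩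
    a + D + (a′ + t′) + (a + t)     ≤⟨ ℕₚ.+-monoʳ-≤ (a + D + (a′ + t′)) (ℕₚ.<⇒≤ b<b′) ⟩
    a + D + (a′ + t′) + (a′ + t′)   ≡⟨ regroup″ a a′ t′ D ⟩
    a + a′ + (a′ + t′) + (t′ + D)   ∎)
  where
  open ℕₚ.≤-Reasoning
  regroup : ∀ a a′ t t′ → a + a′ + (a′ + t′) + t ≡ a′ + (a′ + t′) + (a + t)
  regroup = solve-∀
  regroup′ : ∀ a t D b′ → a + (a + t) + D + b′ ≡ a + D + b′ + (a + t)
  regroup′ = solve-∀
  regroup″ : ∀ a a′ t′ D → a + D + (a′ + t′) + (a′ + t′) ≡ a + a′ + (a′ + t′) + (t′ + D)
  regroup″ = solve-∀

spans-close′ : ∀ {a b t a′ b′ t′ D} → a + t ≡ b → a′ + t′ ≡ b′ → a ℕ.< a′ →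
               a′ + b′ ℕ.< a + b + D → t′ ℕ.< t + D
spans-close′ {a} {_} {t} {a′} {_} {t′} {D} refl refl a<a′ S′<S+D =
  ℕₚ.+-cancelˡ-< (a + a′ + a′) _ _ (begin-strict
    a + a′ + a′ + t′                ≡⟨ regroup a a′ t′ ⟩
    a′ + (a′ + t′) + a              <⟨ ℕₚ.+-mono-< S′<S+D a<a′ ⟩
    a + (a + t) + D + a′            ≤⟨ ℕₚ.+-monoˡ-≤ a′ (ℕₚ.+-monoˡ-≤ D (ℕₚ.+-monoˡ-≤ (a + t) (ℕₚ.<⇒≤ a<a′))) ⟩
    a′ + (a + t) + D + a′           ≡⟨ regroup′ a a′ t D ⟩
    a + a′ + a′ + (t + D)           ∎)
  where
  open ℕₚ.≤-Reasoning
  regroup : ∀ a a′ t′ → a + a′ + a′ + t′ ≡ a′ + (a′ + t′) + a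
  regroup = solve-∀
  regroup′ : ∀ a a′ t D → a′ + (a + t) + D + a′ ≡ a + a′ + a′ + (t + D)
  regroup′ = solve-∀

module _ {n : ℕ} .{{_ : ℕ.NonZero n}} where

  %-gap : ∀ {x y} → x % n ≡ y % n → x ℕ.< y → x + n ℕ.≤ y
  %-gap {x} {y} eq x<y with (y / n) ℕₚ.≤? (x / n)
  ... | yes y/n≤x/n = ⊥-elim (ℕₚ.<⇒≱ x<y (begin
    y                     ≡⟨ m≡m%n+[m/n]*n y n ⟩
    y % n + (y / n) * n   ≡⟨ cong (_+ _) (sym eq) ⟩
    x % n + (y / n) * n   ≤⟨ ℕₚ.+-monoʳ-≤ (x % n) (ℕₚ.*-monoˡ-≤ n y/n≤x/n) ⟩
    x % n + (x / n) * n   ≡⟨ m≡m%n+[m/n]*n x n ⟨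
    x                     ∎))
    where open ℕₚ.≤-Reasoning
  ... | no y/n≰x/n = begin
    x + n                       ≡⟨ cong (_+ n) (m≡m%n+[m/n]*n x n) ⟩
    x % n + (x / n) * n + n     ≡⟨ shift (x % n) (x / n) n ⟩
    x % n + suc (x / n) * n     ≤⟨ ℕₚ.+-monoʳ-≤ (x % n) (ℕₚ.*-monoˡ-≤ n (ℕₚ.≰⇒> y/n≰x/n)) ⟩
    x % n + (y / n) * n         ≡⟨ cong (_+ _) eq ⟩
    y % n + (y / n) * n         ≡⟨ m≡m%n+[m/n]*n y n ⟨
    y                           ∎
    where
    open ℕₚ.≤-Reasoning
    shift : ∀ a b n → a + b * n + n ≡ a + suc b * n
    shift = solve-∀

  %-close : ∀ {x y} → x % n ≡ y % n → x ℕ.< y + n → y ℕ.< x + n → x ≡ y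
  %-close {x} {y} eq x<y+n y<x+n with ℕₚ.<-cmp x y
  ... | tri< x<y _ _ = ⊥-elim (ℕₚ.<⇒≱ y<x+n (%-gap eq x<y))
  ... | tri≈ _ x≡y _ = x≡y
  ... | tri> _ _ y<x = ⊥-elim (ℕₚ.<⇒≱ x<y+n (%-gap (sym eq) y<x))

  module _ {a b t a′ b′ t′ : ℕ} (b≡ : a + t ≡ b) (b′≡ : a′ + t′ ≡ b′)
           (0<t : 0 ℕ.< t) (0<t′ : 0 ℕ.< t′) (t<n : t ℕ.< n) (t′<n : t′ ℕ.< n) where

    private
      a<b : a ℕ.< b
      a<b = subst (a ℕ.<_) b≡ (ℕₚ.m<m+n a 0<t)
      a′<b′ : a′ ℕ.< b′
      a′<b′ = subst (a′ ℕ.<_) b′≡ (ℕₚ.m<m+n a′ 0<t′)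
      b<a+n : b ℕ.< a + n
      b<a+n = subst (ℕ._< a + n) b≡ (ℕₚ.+-monoʳ-< a t<n)
      b′<a′+n : b′ ℕ.< a′ + n
      b′<a′+n = subst (ℕ._< a′ + n) b′≡ (ℕₚ.+-monoʳ-< a′ t′<n)

    -- Congruent ends that differ are at least `n` apart. As both intervals are shorter than `n`,
    -- such a shift of one end forces a shift of the other in the same direction, and the sums would
    -- differ by at least `n`. If no end is shifted, the sums agree.
    ¬congruent< : a + b ℕ.< a′ + b′ → a′ + b′ ℕ.< a + b + n → a % n ≡ a′ % n → ¬ b % n ≡ b′ % n
    ¬congruent< S<S′ S′<S+n a≡ b≡ with ℕₚ.<-cmp a a′ | ℕₚ.<-cmp b b′
    ... | tri< a<a′ _ _ | tri< b<b′ _ _ = ℕₚ.<⇒≱ S′<S+n (begin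
      a + b + n    ≡⟨ swap₃ a b n ⟩
      a + n + b    ≤⟨ ℕₚ.+-mono-≤ (%-gap a≡ a<a′) (ℕₚ.<⇒≤ b<b′) ⟩
      a′ + b′      ∎)
      where
      open ℕₚ.≤-Reasoning
      swap₃ : ∀ a b c → a + b + c ≡ a + c + b
      swap₃ = solve-∀
    ... | tri< a<a′ _ _ | tri≈ _ refl _ = ℕₚ.<⇒≱ b<a+n (ℕₚ.≤-trans (%-gap a≡ a<a′) (ℕₚ.<⇒≤ a′<b′))
    ... | tri< a<a′ _ _ | tri> _ _ b′<b = ℕₚ.<⇒≱ b<a+n
      (ℕₚ.≤-trans (%-gap a≡ a<a′) (ℕₚ.<⇒≤ (ℕₚ.<-trans a′<b′ b′<b)))
    ... | tri≈ _ refl _ | tri< b<b′ _ _ = ℕₚ.<⇒≱ b′<a′+n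
      (ℕₚ.≤-trans (ℕₚ.+-monoˡ-≤ n (ℕₚ.<⇒≤ a<b)) (%-gap b≡ b<b′))
    ... | tri≈ _ refl _ | tri≈ _ refl _ = ℕₚ.<-irrefl refl S<S′
    ... | tri≈ _ refl _ | tri> _ _ b′<b = ℕₚ.<-asym S<S′ (ℕₚ.+-monoʳ-< a b′<b)
    ... | tri> _ _ a′<a | tri< b<b′ _ _ = ℕₚ.<⇒≱ b′<a′+n
      (ℕₚ.≤-trans (%-gap (sym a≡) a′<a) (ℕₚ.<⇒≤ (ℕₚ.<-trans a<b b<b′)))
    ... | tri> _ _ a′<a | tri≈ _ refl _ = ℕₚ.<-asym S<S′ (ℕₚ.+-monoˡ-< b a′<a)
    ... | tri> _ _ a′<a | tri> _ _ b′<b = ℕₚ.<-asym S<S′ (ℕₚ.+-mono-< a′<a b′<b)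

    -- Reversing one of the edges shifts its sum by an odd multiple of n.
    ¬reversed : a + b ℕ.< a′ + b′ + n → a′ + b′ ℕ.< a + b + n → a % n ≡ b′ % n → ¬ b % n ≡ a′ % n
    ¬reversed S<S′+n S′<S+n a≡ b≡ with ℕₚ.<-cmp a b′ | ℕₚ.<-cmp b a′
    ... | _               | tri< b<a′ _ _ = ℕₚ.<⇒≱ S′<S+n (begin
      a + b + n    ≡⟨ ℕₚ.+-assoc a b n ⟩
      a + (b + n)  ≤⟨ ℕₚ.+-mono-≤ (ℕₚ.<⇒≤ (ℕₚ.<-trans a<b (ℕₚ.<-trans b<a′ a′<b′))) (%-gap b≡ b<a′) ⟩
      b′ + a′      ≡⟨ ℕₚ.+-comm b′ a′ ⟩
      a′ + b′      ∎)
      where open ℕₚ.≤-Reasoning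
    ... | tri< a<b′ _ _   | tri≈ _ refl _ = ℕₚ.<⇒≱ S′<S+n (begin
      a + b + n    ≡⟨ rotate a b n ⟩
      b + (a + n)  ≤⟨ ℕₚ.+-monoʳ-≤ b (%-gap a≡ a<b′) ⟩
      b + b′       ∎)
      where
      open ℕₚ.≤-Reasoning
      rotate : ∀ a b c → a + b + c ≡ b + (a + c)
      rotate = solve-∀
    ... | tri< a<b′ _ _   | tri> _ _ a′<b = ℕₚ.<⇒≱ (ℕₚ.+-mono-< b<a+n b′<a′+n) (begin
      a + n + (a′ + n)  ≤⟨ ℕₚ.+-mono-≤ (%-gap a≡ a<b′) (%-gap (sym b≡) a′<b) ⟩
      b′ + b            ≡⟨ ℕₚ.+-comm b′ b ⟩
      b + b′            ∎)
      where open ℕₚ.≤-Reasoning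
    ... | tri≈ _ refl _   | tri≈ _ refl _ = ℕₚ.<-asym a<b a′<b′
    ... | tri≈ _ refl _   | tri> _ _ a′<b = ℕₚ.<⇒≱ S<S′+n (begin
      a′ + a + n   ≡⟨ rotate a′ a n ⟩
      a + (a′ + n) ≤⟨ ℕₚ.+-monoʳ-≤ a (%-gap (sym b≡) a′<b) ⟩
      a + b        ∎)
      where
      open ℕₚ.≤-Reasoning
      rotate : ∀ a b c → a + b + c ≡ b + (a + c)
      rotate = solve-∀
    ... | tri> _ _ b′<a   | tri≈ _ refl _ = ℕₚ.<-asym a<b (ℕₚ.<-trans a′<b′ b′<a)
    ... | tri> _ _ b′<a   | tri> _ _ a′<b = ℕₚ.<⇒≱ S<S′+n (begin
      a′ + b′ + n   ≡⟨ ℕₚ.+-assoc a′ b′ n ⟩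
      a′ + (b′ + n) ≤⟨ ℕₚ.+-mono-≤ (ℕₚ.<⇒≤ a′<b) (%-gap (sym a≡) b′<a) ⟩
      b + a         ≡⟨ ℕₚ.+-comm b a ⟩
      a + b         ∎)
      where open ℕₚ.≤-Reasoning

    -- Intervals that are not nested are shifted against each other in one direction at both ends;
    -- this gives the strict inequalities that `spans-close` and `spans-close′` require.
    nested-or-close : ∀ {D} → a + b ℕ.< a′ + b′ + D → a′ + b′ ℕ.< a + b + D →
      (a ℕ.≤ a′ × b′ ℕ.≤ b) ⊎ (a′ ℕ.≤ a × b ℕ.≤ b′) ⊎ (t ℕ.< t′ + D × t′ ℕ.< t + D)
    nested-or-close {D} S<S′+D S′<S+D with ℕₚ.<-cmp a a′ | ℕₚ.<-cmp b b′
    ... | tri< a<a′ _ _   | tri≈ _ b≡b′ _ = inj₁ (ℕₚ.<⇒≤ a<a′ , ℕₚ.≤-reflexive (sym b≡b′))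
    ... | tri< a<a′ _ _   | tri> _ _ b′<b = inj₁ (ℕₚ.<⇒≤ a<a′ , ℕₚ.<⇒≤ b′<b)
    ... | tri≈ _ a≡a′ _   | tri≈ _ b≡b′ _ = inj₁ (ℕₚ.≤-reflexive a≡a′ , ℕₚ.≤-reflexive (sym b≡b′))
    ... | tri≈ _ a≡a′ _   | tri> _ _ b′<b = inj₁ (ℕₚ.≤-reflexive a≡a′ , ℕₚ.<⇒≤ b′<b)
    ... | tri≈ _ a≡a′ _   | tri< b<b′ _ _ = inj₂ (inj₁ (ℕₚ.≤-reflexive (sym a≡a′) , ℕₚ.<⇒≤ b<b′))
    ... | tri> _ _ a′<a   | tri< b<b′ _ _ = inj₂ (inj₁ (ℕₚ.<⇒≤ a′<a , ℕₚ.<⇒≤ b<b′))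
    ... | tri> _ _ a′<a   | tri≈ _ b≡b′ _ = inj₂ (inj₁ (ℕₚ.<⇒≤ a′<a , ℕₚ.≤-reflexive b≡b′))
    ... | tri< a<a′ _ _   | tri< b<b′ _ _ = inj₂ (inj₂
      (spans-close b≡ b′≡ b<b′ S′<S+D , spans-close′ b≡ b′≡ a<a′ S′<S+D))
    ... | tri> _ _ a′<a   | tri> _ _ b′<b = inj₂ (inj₂
      (spans-close′ b′≡ b≡ a′<a S<S′+D , spans-close b′≡ b≡ b′<b S<S′+D))

  reduce : ∀ a p → (a + p) % n ≡ (a % n + p) % n
  reduce a p = begin
    (a + p) % n                       ≡⟨ cong (λ x → (x + p) % n) (m≡m%n+[m/n]*n a n) ⟩
    (a % n + (a / n) * n + p) % n     ≡⟨ cong (_% n) (shift (a % n) ((a / n) * n) p) ⟩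
    (a % n + p + (a / n) * n) % n     ≡⟨ [m+kn]%n≡m%n (a % n + p) (a / n) n ⟩
    (a % n + p) % n                   ∎
    where
    open ≡-Reasoning
    shift : ∀ a b c → a + b + c ≡ a + c + b
    shift = solve-∀

  residue : ∀ a p → p ℕ.< n → (a + p) % n ≡ a % n + p ⊎ (a + p) % n + n ≡ a % n + p
  residue a p p<n with (a % n + p) ℕₚ.<? n
  ... | yes small = inj₁ (trans (reduce a p) (m<n⇒m%n≡m small))
  ... | no  large = inj₂ (trans (cong (_+ n) (trans (reduce a p) wrapped)) (ℕₚ.m∸n+n≡m n≤))
    where
    n≤ : n ℕ.≤ a % n + p
    n≤ = ℕₚ.≮⇒≥ large
    excess<n : a % n + p ∸ n ℕ.< n
    excess<n = ℕₚ.+-cancelʳ-< n _ _ (subst (ℕ._< n + n) (sym (ℕₚ.m∸n+n≡m n≤))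
      (ℕₚ.+-mono-< (m%n<n a n) p<n))
    wrapped : (a % n + p) % n ≡ a % n + p ∸ n
    wrapped = begin
      (a % n + p) % n           ≡⟨ cong (_% n) (ℕₚ.m∸n+n≡m n≤) ⟨
      (a % n + p ∸ n + n) % n   ≡⟨ [m+n]%n≡m%n (a % n + p ∸ n) n ⟩
      (a % n + p ∸ n) % n       ≡⟨ m<n⇒m%n≡m excess<n ⟩
      a % n + p ∸ n             ∎
      where open ≡-Reasoning

  -- `a` and `b` bound an interval of positions before reduction; reduction modulo `n` may reverse
  -- the order of its ends.
  Ends : ℕ → ℕ → ℕ → ℕ → Set
  Ends x y a b = (x ≡ a % n × y ≡ b % n) ⊎ (x ≡ b % n × y ≡ a % n)

  -- An interval shorter than `n` becomes one of the two arcs between the ends of the chord. If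
  -- reduction does not wrap around between `a` and `b`, this is the segment from `x` to `y`;
  -- otherwise it is the complementary arc, and `x` and `y` come from `b` and `a`.
  arc-side : ∀ {x y a b} → x ℕ.< y → Ends x y a b → a ℕ.≤ b → b ℕ.< a + n →
             (∀ {z} → a ℕ.≤ z → z ℕ.≤ b → Inside x y (z % n)) ⊎
             (∀ {z} → a ℕ.≤ z → z ℕ.≤ b → Outside x y (z % n))
  arc-side {a = a} x<y ends a≤b b<a+n with t , refl ← ℕₚ.m≤n⇒∃[o]m+o≡n a≤b
    with ℕₚ.+-cancelˡ-< a t n b<a+n
  ... | t<n with residue a t t<n
  ... | inj₁ flat = inj₁ (inside ends)
    where
    inside : ∀ {z} → Ends _ _ a (a + t) → a ℕ.≤ z → z ℕ.≤ a + t → Inside _ _ (z % n)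
    inside ends a≤z z≤b with p , refl ← ℕₚ.m≤n⇒∃[o]m+o≡n a≤z
      with p≤t ← ℕₚ.+-cancelˡ-≤ a p t z≤b
      with residue a p (ℕₚ.≤-<-trans p≤t t<n) | ends
    ... | inj₂ wrap | _ = ⊥-elim (ℕₚ.<⇒≱ (m%n<n (a + t) n) (begin
      n                    ≤⟨ ℕₚ.m≤n+m n _ ⟩
      (a + p) % n + n      ≡⟨ wrap ⟩
      a % n + p            ≤⟨ ℕₚ.+-monoʳ-≤ (a % n) p≤t ⟩
      a % n + t            ≡⟨ flat ⟨
      (a + t) % n          ∎))
      where open ℕₚ.≤-Reasoning
    ... | inj₁ flat′ | inj₁ (refl , refl) = subst (a % n ℕ.≤_) (sym flat′) (ℕₚ.m≤m+n _ p) ,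
      subst₂ ℕ._≤_ (sym flat′) (sym flat) (ℕₚ.+-monoʳ-≤ (a % n) p≤t)
    ... | inj₁ flat′ | inj₂ (refl , refl) = ⊥-elim (ℕₚ.<⇒≱ x<y
      (subst (a % n ℕ.≤_) (sym flat) (ℕₚ.m≤m+n _ t)))
  ... | inj₂ wrap = inj₂ (outside ends)
    where
    wrapped< : (a + t) % n ℕ.< a % n
    wrapped< = ℕₚ.+-cancelʳ-< n _ _ (subst (ℕ._< a % n + n) (sym wrap) (ℕₚ.+-monoʳ-< (a % n) t<n))
    outside : ∀ {z} → Ends _ _ a (a + t) → a ℕ.≤ z → z ℕ.≤ a + t → Outside _ _ (z % n)
    outside ends a≤z z≤b with p , refl ← ℕₚ.m≤n⇒∃[o]m+o≡n a≤z
      with p≤t ← ℕₚ.+-cancelˡ-≤ a p t z≤b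
      with residue a p (ℕₚ.≤-<-trans p≤t t<n) | ends
    ... | _ | inj₁ (refl , refl) = ⊥-elim (ℕₚ.<-asym x<y wrapped<)
    ... | inj₁ flat  | inj₂ (refl , refl) = inj₂ (subst (a % n ℕ.≤_) (sym flat) (ℕₚ.m≤m+n _ p))
    ... | inj₂ wrap′ | inj₂ (refl , refl) = inj₁ (ℕₚ.+-cancelʳ-≤ n _ _
      (subst₂ ℕ._≤_ (sym wrap′) (sym wrap) (ℕₚ.+-monoʳ-≤ (a % n) p≤t)))

  -- Both ends of the inner interval are points of the outer one, so `arc-side` puts their residues
  -- on a common arc.
  nested⇒SameSide : ∀ {x y u v a b a′ b′} → x ℕ.< y → Ends x y a b → Ends u v a′ b′ →
                    b ℕ.< a + n → a ℕ.≤ a′ → a′ ℕ.≤ b′ → b′ ℕ.≤ b → SameSide x y u v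
  nested⇒SameSide x<y ends ends′ b<a+n a≤a′ a′≤b′ b′≤b
    with a≤b′ ← ℕₚ.≤-trans a≤a′ a′≤b′ | a′≤b ← ℕₚ.≤-trans a′≤b′ b′≤b
    with arc-side x<y ends (ℕₚ.≤-trans a≤a′ a′≤b) b<a+n | ends′
  ... | inj₁ inside  | inj₁ (refl , refl) = inj₁ (inside a≤a′ a′≤b , inside a≤b′ b′≤b)
  ... | inj₁ inside  | inj₂ (refl , refl) = inj₁ (inside a≤b′ b′≤b , inside a≤a′ a′≤b)
  ... | inj₂ outside | inj₁ (refl , refl) = inj₂ (outside a≤a′ a′≤b , outside a≤b′ b′≤b)
  ... | inj₂ outside | inj₂ (refl , refl) = inj₂ (outside a≤b′ b′≤b , outside a≤a′ a′≤b)

-- The zigzag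

-- The slots of a caterpillar with σ spine vertices of degree suc d: origin is a leaf at
-- the first spine vertex, root the first spine vertex, and at q k is the k-th neighbour
-- of the q-th spine vertex, not counting the preceding one. A key names the edge that
-- joins its slot to an earlier slot.
data Slot (σ d : ℕ) : Set where
  origin root : Slot σ d
  at          : Fin σ → Fin d → Slot σ d

data Key (σ d : ℕ) : Set where
  root : Key σ d
  at   : Fin σ → Fin d → Key σ d

-- The number of the edge in the traversal, from 1: the root edge comes first and every block takes
-- the next `d` numbers.
span : ∀ {σ d} → Key σ d → ℕ
span         root     = 1
span {d = d} (at q k) = 2 + (d * toℕ q + toℕ k)

span-combine : ∀ {σ d} (q : Fin σ) (k : Fin d) → span (at q k) ≡ 2 + toℕ (combine q k)
span-combine q k = cong (2 +_) (sym (Finₚ.toℕ-combine q k))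

span-injective : ∀ {σ d} {κ λ′ : Key σ d} → span κ ≡ span λ′ → κ ≡ λ′
span-injective {κ = root}   {root}     _  = refl
span-injective {κ = at q k} {at q′ k′} eq with refl , refl ← Finₚ.combine-injective q k q′ k′
    (Finₚ.toℕ-injective (ℕₚ.+-cancelˡ-≡ 2 _ _
      (trans (sym (span-combine q k)) (trans eq (span-combine q′ k′))))) = refl

0<span : ∀ {σ d} (κ : Key σ d) → 0 ℕ.< span κ
0<span root     = s≤s z≤n
0<span (at _ _) = s≤s z≤n

span< : ∀ {σ d} (κ : Key σ d) → span κ ℕ.< 2 + σ * d
span< root = s≤s (s≤s z≤n)
span< {σ} {d} (at q k) = subst (ℕ._< 2 + σ * d) (sym (span-combine q k)) (s≤s (s≤s (Finₚ.toℕ<n (combine q k))))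

next-multiple : ∀ d q → suc (d * q) + d ≡ suc (d * suc q)
next-multiple = solve-∀

module Strip (d : ℕ) where

  rightward : ℕ → Bool
  rightward zero    = true
  rightward (suc q) = not (rightward q)

  -- How far the vertices placed before block q extend to the left and to the right of
  -- the origin.
  L R : ℕ → ℕ
  L zero    = 1
  L (suc q) = if rightward q then L q else L q + d
  R zero    = 0
  R (suc q) = if rightward q then R q + d else R q

  -- The quantity `1 + r - l` is 0 before a rightward block and `d` before a leftward one. A block
  -- moves it in unit steps from one extreme to the other, which is what confines the sums to a
  -- window of `d + 1` values.
  Balanced : Bool → ℕ → ℕ → Set
  Balanced true  l r = l ≡ suc r
  Balanced false l r = suc r ≡ l + d

  balanced : ∀ q → Balanced (rightward q) (L q) (R q)
  balanced zero = refl
  balanced (suc q) with rightward q | balanced q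
  ... | true  | l≡1+r   = cong (_+ d) (sym l≡1+r)
  ... | false | 1+r≡l+d = sym 1+r≡l+d

  -- The occupied stretch has `L q + R q + 1` positions, room for the origin, the root and `q`
  -- blocks of `d` vertices.
  L+R : ∀ q → L q + R q ≡ suc (d * q)
  L+R zero = cong suc (sym (ℕₚ.*-zeroʳ d))
  L+R (suc q) with rightward q
  ... | true  = trans (grow-R (L q) (R q) d) (trans (cong (_+ d) (L+R q)) (next-multiple d q))
    where
    grow-R : ∀ l r d → l + (r + d) ≡ l + r + d
    grow-R = solve-∀
  ... | false = trans (grow-L (L q) (R q) d) (trans (cong (_+ d) (L+R q)) (next-multiple d q))
    where
    grow-L : ∀ l r d → l + d + r ≡ l + r + d
    grow-L = solve-∀

  L-step : ∀ q → L q ℕ.≤ L (suc q)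
  L-step q with rightward q
  ... | true  = ℕₚ.≤-refl
  ... | false = ℕₚ.m≤m+n _ _

  R-step : ∀ q → R q ℕ.≤ R (suc q)
  R-step q with rightward q
  ... | true  = ℕₚ.m≤m+n _ _
  ... | false = ℕₚ.≤-refl

  stepwise-mono : ∀ (f : ℕ → ℕ) → (∀ q → f q ℕ.≤ f (suc q)) → ∀ {p q} → p ℕ.≤′ q → f p ℕ.≤ f q
  stepwise-mono f step ℕ.≤′-refl      = ℕₚ.≤-refl
  stepwise-mono f step (ℕ.≤′-step le) = ℕₚ.≤-trans (stepwise-mono f step le) (step _)

  L-mono : ∀ {p q} → p ℕ.≤ q → L p ℕ.≤ L q
  L-mono = stepwise-mono L L-step ∘ ℕₚ.≤⇒≤′

  R-mono : ∀ {p q} → p ℕ.≤ q → R p ℕ.≤ R q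
  R-mono = stepwise-mono R R-step ∘ ℕₚ.≤⇒≤′

  left right : ∀ {σ} → Key σ d → ℕ
  left  root     = 1
  left  (at q k) = if rightward (toℕ q) then L (toℕ q) else L (toℕ q) + suc (toℕ k)
  right root     = 0
  right (at q k) = if rightward (toℕ q) then R (toℕ q) + suc (toℕ k) else R (toℕ q)

  left+right : ∀ {σ} (κ : Key σ d) → left κ + right κ ≡ span κ
  left+right root = refl
  left+right (at q k) with rightward (toℕ q)
  ... | true  = trans (reassoc (L (toℕ q)) (R (toℕ q)) (toℕ k))
                      (cong (λ x → suc (x + toℕ k)) (L+R (toℕ q)))
    where
    reassoc : ∀ l r k → l + (r + suc k) ≡ suc (l + r + k)
    reassoc = solve-∀
  ... | false = trans (reassoc (L (toℕ q)) (R (toℕ q)) (toℕ k))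
                      (cong (λ x → suc (x + toℕ k)) (L+R (toℕ q)))
    where
    reassoc : ∀ l r k → l + suc k + r ≡ suc (l + r + k)
    reassoc = solve-∀

  left≤1+right : ∀ {σ} (κ : Key σ d) → left κ ℕ.≤ suc (right κ)
  left≤1+right root = s≤s z≤n
  left≤1+right (at q k) with rightward (toℕ q) | balanced (toℕ q)
  ... | true  | l≡1+r   = ℕₚ.≤-trans (ℕₚ.≤-reflexive l≡1+r) (s≤s (ℕₚ.m≤m+n _ _))
  ... | false | 1+r≡l+d = ℕₚ.≤-trans (ℕₚ.+-monoʳ-≤ (L (toℕ q)) (Finₚ.toℕ<n k))
                                     (ℕₚ.≤-reflexive (sym 1+r≡l+d))

  1+right≤left+d : ∀ {σ} (κ : Key σ d) → suc (right κ) ℕ.≤ left κ + d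
  1+right≤left+d root = s≤s z≤n
  1+right≤left+d (at q k) with rightward (toℕ q) | balanced (toℕ q)
  ... | true  | l≡1+r   = ℕₚ.≤-trans (s≤s (ℕₚ.+-monoʳ-≤ (R (toℕ q)) (Finₚ.toℕ<n k)))
                                     (ℕₚ.≤-reflexive (cong (_+ d) (sym l≡1+r)))
  ... | false | 1+r≡l+d = ℕₚ.≤-trans (ℕₚ.≤-reflexive 1+r≡l+d) (ℕₚ.+-monoˡ-≤ d (ℕₚ.m≤m+n _ _))

  left≤ : ∀ {σ} (κ : Key σ d) → left κ ℕ.≤ L σ
  left≤ {σ} root = L-mono {0} {σ} z≤n
  left≤ {σ} (at q k) = ℕₚ.≤-trans bound (L-mono (Finₚ.toℕ<n q))
    where
    bound : left (at q k) ℕ.≤ L (suc (toℕ q))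
    bound with rightward (toℕ q)
    ... | true  = ℕₚ.≤-refl
    ... | false = ℕₚ.+-monoʳ-≤ (L (toℕ q)) (Finₚ.toℕ<n k)

  right≤ : ∀ {σ} (κ : Key σ d) → right κ ℕ.≤ R σ
  right≤ root = z≤n
  right≤ {σ} (at q k) = ℕₚ.≤-trans bound (R-mono (Finₚ.toℕ<n q))
    where
    bound : right (at q k) ℕ.≤ R (suc (toℕ q))
    bound with rightward (toℕ q)
    ... | true  = ℕₚ.+-monoʳ-≤ (R (toℕ q)) (Finₚ.toℕ<n k)
    ... | false = ℕₚ.≤-refl

  -- Meant for `f` equal to `L` or `R`: a block placed on that side fills the distances above `f q`
  -- up to `f (suc q)`, and later blocks on the side start no lower.
  block-separate : ∀ (f : ℕ → ℕ) → (∀ {p q} → p ℕ.≤ q → f p ℕ.≤ f q) →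
                   ∀ {q q′} (k k′ : Fin d) → f (suc q) ≡ f q + d → q ℕ.< q′ →
                   f q + suc (toℕ k) ℕ.< f q′ + suc (toℕ k′)
  block-separate f mono {q} {q′} k k′ grow q<q′ = begin-strict
    f q + suc (toℕ k)   ≤⟨ ℕₚ.+-monoʳ-≤ (f q) (Finₚ.toℕ<n k) ⟩
    f q + d             ≡⟨ grow ⟨
    f (suc q)           ≤⟨ mono q<q′ ⟩
    f q′                <⟨ ℕₚ.m<m+n (f q′) (s≤s z≤n) ⟩
    f q′ + suc (toℕ k′) ∎
    where open ℕₚ.≤-Reasoning

  block-unique : ∀ (f : ℕ → ℕ) → (∀ {p q} → p ℕ.≤ q → f p ℕ.≤ f q) →
                 ∀ {σ} (q q′ : Fin σ) (k k′ : Fin d) →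
                 f (suc (toℕ q)) ≡ f (toℕ q) + d → f (suc (toℕ q′)) ≡ f (toℕ q′) + d →
                 f (toℕ q) + suc (toℕ k) ≡ f (toℕ q′) + suc (toℕ k′) → q ≡ q′ × k ≡ k′
  block-unique f mono q q′ k k′ grow grow′ eq with Finₚ.<-cmp q q′
  ... | tri< q<q′ _ _ = ⊥-elim (ℕₚ.<-irrefl eq (block-separate f mono k k′ grow q<q′))
  ... | tri≈ _ refl _ = refl , Finₚ.toℕ-injective (ℕₚ.suc-injective (ℕₚ.+-cancelˡ-≡ (f (toℕ q)) _ _ eq))
  ... | tri> _ _ q′<q = ⊥-elim (ℕₚ.<-irrefl (sym eq) (block-separate f mono k′ k grow′ q′<q))

  L-grow : ∀ q → rightward q ≡ false → L (suc q) ≡ L q + d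
  L-grow q eq rewrite eq = refl

  R-grow : ∀ q → rightward q ≡ true → R (suc q) ≡ R q + d
  R-grow q eq rewrite eq = refl

  -- l c and r c are the positions c steps to the left and to the right of the origin.
  data Pos : Set where
    l r : ℕ → Pos

  slotPos : ∀ {σ} → Slot σ d → Pos
  slotPos origin   = r 0
  slotPos root     = l 1
  slotPos (at q k) = if rightward (toℕ q) then r (R (toℕ q) + suc (toℕ k))
                                          else l (L (toℕ q) + suc (toℕ k))

  -- The spine vertex of a block sits at the extreme opposite to the direction in which the block is
  -- laid out.
  spinePos : ℕ → Pos
  spinePos q = if rightward q then l (L q) else r (R q)

  1≤L : ∀ q → 1 ℕ.≤ L q
  1≤L q = L-mono {0} {q} z≤n

  l-injective : ∀ {a b} → l a ≡ l b → a ≡ b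
  l-injective refl = refl

  r-injective : ∀ {a b} → r a ≡ r b → a ≡ b
  r-injective refl = refl

  slotPos-injective : ∀ {σ} (u v : Slot σ d) → slotPos u ≡ slotPos v → u ≡ v
  slotPos-injective origin   origin _ = refl
  slotPos-injective origin   (at q k) eq with rightward (toℕ q)
  ... | true  = ⊥-elim (ℕₚ.<-irrefl (r-injective eq) (ℕₚ.m<n⇒0<n (ℕₚ.m<m+n (R (toℕ q)) (s≤s z≤n))))
  ... | false with () ← eq
  slotPos-injective root     root   _ = refl
  slotPos-injective root     (at q k) eq with rightward (toℕ q)
  ... | true  with () ← eq
  ... | false = ⊥-elim (ℕₚ.<-irrefl (l-injective eq)
                  (ℕₚ.≤-<-trans (1≤L (toℕ q)) (ℕₚ.m<m+n (L (toℕ q)) (s≤s z≤n))))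
  slotPos-injective u@(at _ _) origin eq = sym (slotPos-injective origin u (sym eq))
  slotPos-injective u@(at _ _) root   eq = sym (slotPos-injective root u (sym eq))
  slotPos-injective (at q k) (at q′ k′) eq
    with rightward (toℕ q) in b | rightward (toℕ q′) in b′
  ... | true  | true  with refl , refl ← block-unique R R-mono q q′ k k′
                             (R-grow (toℕ q) b) (R-grow (toℕ q′) b′) (r-injective eq) = refl
  ... | true  | false with () ← eq
  ... | false | true  with () ← eq
  ... | false | false with refl , refl ← block-unique L L-mono q q′ k k′
                             (L-grow (toℕ q) b) (L-grow (toℕ q′) b′) (l-injective eq) = refl

  -- The last vertex of a block is the new extreme on its side. As directions alternate, this is
  -- where the next spine vertex belongs, so that vertex has to be listed last.
  last-spinePos : ∀ {σ} (q : Fin σ) (k : Fin d) → suc (toℕ k) ≡ d →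
                  slotPos (at q k) ≡ spinePos (suc (toℕ q))
  last-spinePos q k eq with rightward (toℕ q)
  ... | true  = cong (λ x → r (R (toℕ q) + x)) eq
  ... | false = cong (λ x → l (L (toℕ q) + x)) eq

  -- The bound `1 ≤ c` excludes `l 0`, which would name the same place as `r 0`.
  Within : ℕ → ℕ → Pos → Set
  Within A B (l c) = (1 ℕ.≤ c) × (c ℕ.≤ A)
  Within A B (r c) = c ℕ.≤ B

  slotPos-within : ∀ {σ} (u : Slot σ d) → Within (L σ) (R σ) (slotPos u)
  slotPos-within {σ} origin = z≤n
  slotPos-within {σ} root   = s≤s z≤n , 1≤L σ
  slotPos-within {σ} (at q k) with rightward (toℕ q) | left≤ (Key.at q k) | right≤ (Key.at q k)
  ... | true  | _   | R≤ = R≤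
  ... | false | L≤  | _  = ℕₚ.≤-trans (1≤L (toℕ q)) (ℕₚ.m≤m+n _ _) , L≤

module Embed (d base : ℕ) where
  open Strip d

  -- The truncated subtraction is exact under the assumption, made below, that `base` is at least
  -- the extent to the left.
  embed : Pos → ℕ
  embed (l c) = base ∸ c
  embed (r c) = base + c

  module _ {A B : ℕ} (A≤base : A ℕ.≤ base) where

    base≤embed+A : ∀ p → Within A B p → base ℕ.≤ embed p + A
    base≤embed+A (l c) (_ , c≤A) = ℕₚ.≤-trans (ℕₚ.≤-reflexive (sym (ℕₚ.m∸n+n≡m (ℕₚ.≤-trans c≤A A≤base))))
                                              (ℕₚ.+-monoʳ-≤ (base ∸ c) c≤A)
    base≤embed+A (r c) _ = ℕₚ.≤-trans (ℕₚ.m≤m+n base c) (ℕₚ.m≤m+n _ A)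

    embed≤base+B : ∀ p → Within A B p → embed p ℕ.≤ base + B
    embed≤base+B (l c) _   = ℕₚ.≤-trans (ℕₚ.m∸n≤m base c) (ℕₚ.m≤m+n base B)
    embed≤base+B (r c) c≤B = ℕₚ.+-monoʳ-≤ base c≤B

    embed-injective : ∀ p p′ → Within A B p → Within A B p′ → embed p ≡ embed p′ → p ≡ p′
    embed-injective (l c) (l c′) (_ , c≤A) (_ , c′≤A) eq =
      cong l (ℕₚ.∸-cancelˡ-≡ (ℕₚ.≤-trans c≤A A≤base) (ℕₚ.≤-trans c′≤A A≤base) eq)
    embed-injective (l c) (r c′) (1≤c , c≤A) _ eq = ⊥-elim (ℕₚ.<-irrefl eq
      (ℕₚ.<-≤-trans (ℕₚ.∸-monoʳ-< {base} 1≤c (ℕₚ.≤-trans c≤A A≤base)) (ℕₚ.m≤m+n base c′)))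
    embed-injective (r c) (l c′) _ (1≤c′ , c′≤A) eq = ⊥-elim (ℕₚ.<-irrefl (sym eq)
      (ℕₚ.<-≤-trans (ℕₚ.∸-monoʳ-< {base} 1≤c′ (ℕₚ.≤-trans c′≤A A≤base)) (ℕₚ.m≤m+n base c)))
    embed-injective (r c) (r c′) _ _ eq = cong r (ℕₚ.+-cancelˡ-≡ base c c′ eq)

    -- All positions lie between `base - A` and `base + B`, an interval too short to contain two
    -- different congruent numbers.
    embed-%-injective : ∀ {n} .{{_ : ℕ.NonZero n}} → A + B ℕ.< n →
                        ∀ p p′ → Within A B p → Within A B p′ →
                        embed p % n ≡ embed p′ % n → p ≡ p′
    embed-%-injective {n} A+B<n p p′ w w′ eq =
      embed-injective p p′ w w′ (%-close eq (close p p′ w w′) (close p′ p w′ w))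
      where
      close : ∀ p p′ → Within A B p → Within A B p′ → embed p ℕ.< embed p′ + n
      close p p′ w w′ = begin-strict
        embed p            ≤⟨ embed≤base+B p w ⟩
        base + B           ≤⟨ ℕₚ.+-monoˡ-≤ B (base≤embed+A p′ w′) ⟩
        embed p′ + A + B   ≡⟨ ℕₚ.+-assoc (embed p′) A B ⟩
        embed p′ + (A + B) <⟨ ℕₚ.+-monoʳ-< (embed p′) A+B<n ⟩
        embed p′ + n       ∎
        where open ℕₚ.≤-Reasoning

  lower upper : ∀ {σ} → Key σ d → ℕ
  lower κ = base ∸ left κ
  upper κ = base + right κ

  lower+left : ∀ {σ} → L σ ℕ.≤ base → (κ : Key σ d) → lower κ + left κ ≡ base
  lower+left Lσ≤base κ = ℕₚ.m∸n+n≡m (ℕₚ.≤-trans (left≤ κ) Lσ≤base)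

  lower+span : ∀ {σ} → L σ ℕ.≤ base → (κ : Key σ d) → lower κ + span κ ≡ upper κ
  lower+span Lσ≤base κ = begin
    base ∸ left κ + span κ              ≡⟨ cong (base ∸ left κ +_) (left+right κ) ⟨
    base ∸ left κ + (left κ + right κ)  ≡⟨ ℕₚ.+-assoc (base ∸ left κ) _ _ ⟨
    base ∸ left κ + left κ + right κ    ≡⟨ cong (_+ right κ) (lower+left Lσ≤base κ) ⟩
    base + right κ                      ∎
    where open ≡-Reasoning

  -- The sum of the ends is `2 * base + right κ - left κ`, which may be as small as `2 * base - 1`;
  -- hence the successor. Adding `left κ` on both sides avoids the subtraction.
  window-lower : ∀ {σ} → L σ ℕ.≤ base → (κ : Key σ d) → 2 * base ℕ.≤ suc (lower κ + upper κ)
  window-lower Lσ≤base κ = ℕₚ.+-cancelʳ-≤ (left κ) _ _ (begin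
    2 * base + left κ                        ≤⟨ ℕₚ.+-monoʳ-≤ (2 * base) (left≤1+right κ) ⟩
    2 * base + suc (right κ)
      ≡⟨ cong (λ b → b + (base + 0) + suc (right κ)) (lower+left Lσ≤base κ) ⟨
    lower κ + left κ + (base + 0) + suc (right κ) ≡⟨ shuffle (lower κ) (left κ) base (right κ) ⟩
    suc (lower κ + upper κ) + left κ         ∎)
    where
    open ℕₚ.≤-Reasoning
    shuffle : ∀ a b c d → a + b + (c + 0) + suc d ≡ suc (a + (c + d)) + b
    shuffle = solve-∀

  window-upper : ∀ {σ} → L σ ℕ.≤ base → (κ : Key σ d) → suc (lower κ + upper κ) ℕ.≤ 2 * base + d
  window-upper Lσ≤base κ = ℕₚ.+-cancelʳ-≤ (left κ) _ _ (begin
    suc (lower κ + upper κ) + left κ         ≡⟨ shuffle (lower κ) (left κ) base (right κ) ⟩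
    lower κ + left κ + (base + 0) + suc (right κ)
      ≡⟨ cong (λ b → b + (base + 0) + suc (right κ)) (lower+left Lσ≤base κ) ⟩
    2 * base + suc (right κ)                 ≤⟨ ℕₚ.+-monoʳ-≤ (2 * base) (1+right≤left+d κ) ⟩
    2 * base + (left κ + d)                  ≡⟨ swap (2 * base) (left κ) d ⟩
    2 * base + d + left κ                    ∎)
    where
    open ℕₚ.≤-Reasoning
    shuffle : ∀ a b c d → suc (a + (c + d)) + b ≡ a + b + (c + 0) + suc d
    shuffle = solve-∀
    swap : ∀ a b c → a + (b + c) ≡ a + c + b
    swap = solve-∀

  block-ends : ∀ {σ} (q : Fin σ) (k : Fin d) →
    (embed (spinePos (toℕ q)) ≡ lower (at q k) × embed (slotPos (at q k)) ≡ upper (at q k)) ⊎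
    (embed (spinePos (toℕ q)) ≡ upper (at q k) × embed (slotPos (at q k)) ≡ lower (at q k))
  block-ends q k with rightward (toℕ q)
  ... | true  = inj₁ (refl , refl)
  ... | false = inj₂ (refl , refl)

-- The structure of regular caterpillars

Unique-resp-↭ : ∀ {A : Set} {xs ys : List A} → xs ↭ ys → Unique xs → Unique ys
Unique-resp-↭ {A} = PermutationSetoid.Unique-resp-↭ (setoid A) ∘ ↭⇒↭ₛ

lookup-injective : ∀ {A : Set} {xs : List A} → Unique xs → Injective _≡_ _≡_ (lookup xs)
lookup-injective (_   ∷ _) {zero}  {zero}  _  = refl
lookup-injective (x∉ ∷ _)  {zero}  {suc j} eq = ⊥-elim (All.lookup x∉ (∈-lookup j) eq)
lookup-injective (x∉ ∷ _)  {suc i} {zero}  eq = ⊥-elim (All.lookup x∉ (∈-lookup i) (sym eq))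
lookup-injective (_ ∷ u)   {suc i} {suc j} eq = cong suc (lookup-injective u eq)

∈⇒lookup : ∀ {A : Set} {x : A} {xs} → x ∈ xs → ∃[ k ] lookup xs k ≡ x
∈⇒lookup (here refl) = zero , refl
∈⇒lookup (there x∈) with k , eq ← ∈⇒lookup x∈ = suc k , eq

∈⇒↭∷ : ∀ {A : Set} {x : A} {xs} → x ∈ xs → ∃[ ys ] xs ↭ x ∷ ys
∈⇒↭∷ {x = x} x∈ with ys , zs , refl ← ∈-∃++ x∈ = ys ++ zs , ↭-shift x ys zs

lookup-∷ʳ-last : ∀ {A : Set} {x : A} xs → x ∉ xs →
                 ∀ k → lookup (xs ∷ʳ x) k ≡ x → suc (toℕ k) ≡ length (xs ∷ʳ x)
lookup-∷ʳ-last []       _   zero    _  = refl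
lookup-∷ʳ-last (y ∷ xs) x∉ zero    eq = ⊥-elim (x∉ (here (sym eq)))
lookup-∷ʳ-last (y ∷ xs) x∉ (suc k) eq = cong suc (lookup-∷ʳ-last xs (x∉ ∘ there) k eq)

moveLast : ∀ {n} (z : Fin n) ys → Unique ys →
           ∃[ zs ] ys ↭ zs × (∀ k → lookup zs k ≡ z → suc (toℕ k) ≡ length zs)
moveLast z ys uys with Any.any? (z Finₚ.≟_) ys
... | no z∉  = ys , ↭-refl , λ k eq → ⊥-elim (z∉ (subst (_∈ ys) eq (∈-lookup k)))
... | yes z∈ with zs , ys↭ ← ∈⇒↭∷ z∈ = zs ∷ʳ z , ↭-trans ys↭ (∷↭∷ʳ z zs) ,
  lookup-∷ʳ-last zs (Unique[x∷xs]⇒x∉xs (Unique-resp-↭ ys↭ uys))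

-- For the neighbours `xs` of a spine vertex: `p` is the one visited earlier, and `z` is the next
-- spine vertex, which has to come last in the block.
record Enumeration {n} (d : ℕ) (xs : List (Fin n)) (p z : Fin n) : Set where
  field
    enum      : Fin d → Fin n
    injective : Injective _≡_ _≡_ enum
    member    : ∀ k → enum k ∈ xs
    avoids    : ∀ k → enum k ≢ p
    complete  : ∀ {y} → y ∈ xs → y ≡ p ⊎ ∃[ k ] enum k ≡ y
    last      : ∀ k → enum k ≡ z → suc (toℕ k) ≡ d

enumerate : ∀ {n d} (xs : List (Fin n)) p z → Unique xs → p ∈ xs →
            length xs ≡ suc d → Enumeration d xs p z
enumerate xs p z uxs p∈ len
  with ys , xs↭ ← ∈⇒↭∷ p∈
  with p∉ys ∷ uys ← Unique-resp-↭ xs↭ uxs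
  with zs , ys↭ , last ← moveLast z ys uys
  -- This identifies `d` with `length zs`, so that `lookup zs` itself is the enumeration.
  with refl ← ℕₚ.suc-injective (trans (sym len) (trans (↭-length xs↭) (cong suc (↭-length ys↭)))) = record
  { enum      = lookup zs
  ; injective = lookup-injective (Unique-resp-↭ ys↭ uys)
  ; member    = λ k → ∈-resp-↭ (↭-sym xs↭) (there (∈ys k))
  ; avoids    = λ k eq → All.lookup p∉ys (∈ys k) (sym eq)
  ; complete  = λ y∈ → split (∈-resp-↭ xs↭ y∈)
  ; last      = last
  }
  where
  ∈ys : ∀ k → lookup zs k ∈ ys
  ∈ys k = ∈-resp-↭ (↭-sym ys↭) (∈-lookup k)
  split : ∀ {y} → y ∈ p ∷ ys → y ≡ p ⊎ ∃[ k ] lookup zs k ≡ y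
  split (here y≡p) = inj₁ y≡p
  split (there y∈) = inj₂ (∈⇒lookup (∈-resp-↭ ys↭ y∈))

module Neighbours {n : ℕ} (T : Graph n) where
  open Graph T

  ~-sym : ∀ {u v} → u ~ v → v ~ u
  ~-sym {u} {v} = subst Data.Bool.Base.T (symmetric u v)

  -- Its length is `degree v` by computation, so statements about degrees apply to it directly.
  neighbours : Fin n → List (Fin n)
  neighbours v = filter (T? ∘ adjacent v) (allFin n)

  neighbours-unique : ∀ v → Unique (neighbours v)
  neighbours-unique v = filter⁺ (T? ∘ adjacent v) (allFin⁺ n)

  ~⇒∈ : ∀ {v u} → v ~ u → u ∈ neighbours v
  ~⇒∈ {v} {u} v~u = ∈-filter⁺ (T? ∘ adjacent v) (∈-allFin u) v~u

  ∈⇒~ : ∀ {v u} → u ∈ neighbours v → v ~ u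
  ∈⇒~ {v} u∈ = proj₂ (∈-filter⁻ (T? ∘ adjacent v) {xs = allFin n} u∈)

  leaf-unique : ∀ {v a b} → IsLeaf v → v ~ a → v ~ b → a ≡ b
  leaf-unique {v} leaf v~a v~b = single leaf (~⇒∈ v~a) (~⇒∈ v~b)
    where
    single : ∀ {a b} {xs : List (Fin n)} → length xs ≡ 1 → a ∈ xs → b ∈ xs → a ≡ b
    single {xs = x ∷ []} _ (here refl) (here refl) = refl

module Order {n : ℕ} (T : Graph n) (connected : Graph.Connected T)
  {σ′ : ℕ} (s : Fin (suc σ′) → Fin n) (s-injective : Injective _≡_ _≡_ s)
  (nonLeaf : ∀ i → ¬ Graph.IsLeaf T (s i)) (covers : ∀ v → ¬ Graph.IsLeaf T v → ∃[ i ] s i ≡ v)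
  (path : ∀ i j → Graph._~_ T (s i) (s j) ⇔ Consecutive i j)
  {d : ℕ} (degree-s : ∀ i → Graph.degree T (s i) ≡ suc d) (1≤d : 1 ℕ.≤ d) where

  open Graph T
  open Neighbours T

  private
    σ : ℕ
    σ = suc σ′

  -- Follow a walk to the spine. If its first step led to another leaf `u`, the rest of the walk
  -- would make `u` adjacent to a spine vertex as well as to `v`; these would coincide, although `v`
  -- is a leaf.
  leaf-attached : ∀ v → IsLeaf v → ∃[ i ] v ~ s i
  leaf-attached v leaf = walk leaf (connected v (s zero))
    where
    walk : ∀ {v} → IsLeaf v → Star _~_ v (s zero) → ∃[ i ] v ~ s i
    walk leaf Star.ε = ⊥-elim (nonLeaf zero leaf)
    walk {v} leaf (_◅_ {j = u} v~u rest) with degree u ℕₚ.≟ 1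
    ... | no  u-inner with i , refl ← covers u u-inner = i , v~u
    ... | yes u-leaf  with i , u~sᵢ ← walk u-leaf rest =
      ⊥-elim (nonLeaf i (subst IsLeaf (leaf-unique u-leaf (~-sym v~u) u~sᵢ) leaf))

  spine-or-leaf : ∀ v → (∃[ i ] s i ≡ v) ⊎ IsLeaf v
  spine-or-leaf v with degree v ℕₚ.≟ 1
  ... | yes leaf = inj₂ leaf
  ... | no inner = inj₁ (covers v inner)

  -- The first spine vertex has at least two neighbours, and on the spine only the second vertex can
  -- be one of them.
  first-leaf : ∃[ x ] IsLeaf x × s zero ~ x
  first-leaf = pick (neighbours (s zero)) (neighbours-unique (s zero)) (λ y∈ → ∈⇒~ y∈)
    (subst (2 ℕ.≤_) (sym (degree-s zero)) (s≤s 1≤d))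
    where
    spine-nbr : ∀ i → s zero ~ s i → toℕ i ≡ 1
    spine-nbr i adj with Equivalence.to (path zero i) adj
    ... | inj₁ eq = sym eq
    pick : ∀ ys → Unique ys → (∀ {y} → y ∈ ys → s zero ~ y) →
           2 ℕ.≤ length ys → ∃[ x ] IsLeaf x × s zero ~ x
    pick (_ ∷ [])    _ _ (s≤s ())
    pick (a ∷ b ∷ _) ((a≢b ∷ _) ∷ _) adj _ with degree a ℕₚ.≟ 1 | degree b ℕₚ.≟ 1
    ... | yes a-leaf | _          = a , a-leaf , adj (here refl)
    ... | no _       | yes b-leaf = b , b-leaf , adj (there (here refl))
    ... | no a-inner | no b-inner with i , refl ← covers a a-inner | j , refl ← covers b b-inner =
      ⊥-elim (a≢b (cong s (Finₚ.toℕ-injective (trans (spine-nbr i (adj (here refl)))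
        (sym (spine-nbr j (adj (there (here refl)))))))))

  x : Fin n
  x = proj₁ first-leaf

  x-leaf : IsLeaf x
  x-leaf = proj₁ (proj₂ first-leaf)

  s₀~x : s zero ~ x
  s₀~x = proj₂ (proj₂ first-leaf)

  -- The leaf `x` stands in for the predecessor of the first spine vertex, so that every spine
  -- vertex has exactly `d` further neighbours.
  pred : Fin σ → Fin n
  pred zero    = x
  pred (suc q) = s (inject₁ q)

  s~pred : ∀ q → s q ~ pred q
  s~pred zero    = s₀~x
  s~pred (suc q) = Equivalence.from (path (suc q) (inject₁ q)) (inj₂ (cong suc (Finₚ.toℕ-inject₁ q)))

  -- On the last spine vertex any vertex outside its block will do.
  next : Fin σ → Fin n
  next q with suc (toℕ q) ℕₚ.<? σ
  ... | yes lt = s (fromℕ< lt)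
  ... | no  _  = pred q

  next-spine : ∀ q q′ → suc (toℕ q) ≡ toℕ q′ → next q ≡ s q′
  next-spine q q′ eq with suc (toℕ q) ℕₚ.<? σ
  ... | yes lt = cong s (Finₚ.toℕ-injective (trans (Finₚ.toℕ-fromℕ< lt) eq))
  ... | no ≮   = ⊥-elim (≮ (subst (ℕ._< σ) (sym eq) (Finₚ.toℕ<n q′)))

  enumeration : ∀ q → Enumeration d (neighbours (s q)) (pred q) (next q)
  enumeration q = enumerate (neighbours (s q)) (pred q) (next q) (neighbours-unique (s q))
    (~⇒∈ (s~pred q)) (degree-s q)

  module Block (q : Fin σ) = Enumeration (enumeration q)

  block : Fin σ → Fin d → Fin n
  block = Block.enum

  block-adjacent : ∀ q k → s q ~ block q k
  block-adjacent q k = ∈⇒~ (Block.member q k)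

  block-spine : ∀ q k j → block q k ≡ s j → suc (toℕ q) ≡ toℕ j
  block-spine q k j eq with Equivalence.to (path q j) (subst (s q ~_) eq (block-adjacent q k))
  ... | inj₁ next-j = next-j
  block-spine (suc q) k j eq | inj₂ prev-j = ⊥-elim (Block.avoids (suc q) k (trans eq
    (cong s (Finₚ.toℕ-injective (trans (ℕₚ.suc-injective prev-j) (sym (Finₚ.toℕ-inject₁ q)))))))

  vertexAt : Slot σ d → Fin n
  vertexAt origin   = x
  vertexAt root     = s zero
  vertexAt (at q k) = block q k

  x≢s : ∀ i → x ≢ s i
  x≢s i eq = nonLeaf i (subst IsLeaf eq x-leaf)

  x≢block : ∀ q k → x ≢ block q k
  x≢block q k eq with refl ← s-injective (leaf-unique x-leaf (~-sym s₀~x)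
                               (~-sym (subst (s q ~_) (sym eq) (block-adjacent q k)))) =
    Block.avoids zero k (sym eq)

  s₀≢block : ∀ q k → s zero ≢ block q k
  s₀≢block q k eq with () ← block-spine q k zero (sym eq)

  -- A leaf determines its only neighbour, and a spine vertex in a block determines its predecessor
  -- on the spine.
  block-index : ∀ q k q′ k′ → block q k ≡ block q′ k′ → q ≡ q′
  block-index q k q′ k′ eq with degree (block q k) ℕₚ.≟ 1
  ... | yes leaf = s-injective (leaf-unique leaf (~-sym (block-adjacent q k))
                     (~-sym (subst (s q′ ~_) (sym eq) (block-adjacent q′ k′))))
  ... | no inner with j , sⱼ≡ ← covers (block q k) inner = Finₚ.toℕ-injective (ℕₚ.suc-injective
    (trans (block-spine q k j (sym sⱼ≡)) (sym (block-spine q′ k′ j (trans (sym eq) (sym sⱼ≡))))))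

  vertexAt-injective : ∀ {u v} → vertexAt u ≡ vertexAt v → u ≡ v
  vertexAt-injective {origin} {origin}   _  = refl
  vertexAt-injective {origin} {root}     eq = ⊥-elim (x≢s zero eq)
  vertexAt-injective {origin} {at q k}   eq = ⊥-elim (x≢block q k eq)
  vertexAt-injective {root}   {origin}   eq = ⊥-elim (x≢s zero (sym eq))
  vertexAt-injective {root}   {root}     _  = refl
  vertexAt-injective {root}   {at q k}   eq = ⊥-elim (s₀≢block q k eq)
  vertexAt-injective {at q k} {origin}   eq = ⊥-elim (x≢block q k (sym eq))
  vertexAt-injective {at q k} {root}     eq = ⊥-elim (s₀≢block q k (sym eq))
  vertexAt-injective {at q k} {at q′ k′} eq with refl ← block-index q k q′ k′ eq =
    cong (at q) (Block.injective q eq)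

  s≢pred : ∀ {i} q → toℕ i ≡ suc (toℕ q) → s i ≢ pred q
  s≢pred zero    _  eq = x≢s _ (sym eq)
  s≢pred (suc q) i≡ eq = ℕₚ.m+1+n≢n 1 (trans (sym i≡) (trans (cong toℕ (s-injective eq)) (Finₚ.toℕ-inject₁ q)))

  successor-in-block : ∀ q → ∃[ k ] block (inject₁ q) k ≡ s (suc q) × suc (toℕ k) ≡ d
  successor-in-block q = found (Block.complete (inject₁ q)
      (~⇒∈ (Equivalence.from (path (inject₁ q) (suc q)) (inj₁ step))))
    where
    step : suc (toℕ (inject₁ q)) ≡ suc (toℕ q)
    step = cong suc (Finₚ.toℕ-inject₁ q)
    found : s (suc q) ≡ pred (inject₁ q) ⊎ ∃[ k ] block (inject₁ q) k ≡ s (suc q) →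
            ∃[ k ] block (inject₁ q) k ≡ s (suc q) × suc (toℕ k) ≡ d
    found (inj₁ eq)       = ⊥-elim (s≢pred (inject₁ q) (sym step) eq)
    found (inj₂ (k , eq)) = k , eq , Block.last (inject₁ q) k
      (trans eq (sym (next-spine (inject₁ q) (suc q) step)))

  -- A spine vertex is the root or closes the preceding block; a leaf lies in the block of its
  -- neighbour, unless it was removed there as the predecessor, in which case it is the origin.
  vertexAt-surjective : ∀ v → ∃[ u ] vertexAt u ≡ v
  vertexAt-surjective v with degree v ℕₚ.≟ 1
  ... | no inner with covers v inner
  ...   | zero  , eq = root , eq
  ...   | suc q , eq with k , block≡ , _ ← successor-in-block q = at (inject₁ q) k , trans block≡ eq
  vertexAt-surjective v | yes leaf with q , v~sq ← leaf-attached v leaf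
    with Block.complete q (~⇒∈ (~-sym v~sq))
  ... | inj₂ (k , eq) = at q k , eq
  ... | inj₁ v≡pred with q
  ...   | zero   = origin , sym v≡pred
  ...   | suc q′ = ⊥-elim (nonLeaf (inject₁ q′) (subst IsLeaf v≡pred leaf))

  slot : Fin n → Slot σ d
  slot v = proj₁ (vertexAt-surjective v)

  vertexAt-slot : ∀ v → vertexAt (slot v) ≡ v
  vertexAt-slot v = proj₂ (vertexAt-surjective v)

  slot-unique : ∀ {v u} → vertexAt u ≡ v → slot v ≡ u
  slot-unique {v} eq = vertexAt-injective (trans (vertexAt-slot v) (sym eq))

  slot-injective : ∀ {u v} → slot u ≡ slot v → u ≡ v
  slot-injective {u} {v} eq = trans (sym (vertexAt-slot u)) (trans (cong vertexAt eq) (vertexAt-slot v))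

  -- Distinct slots hold distinct vertices; the bound keeps all spans below `n`.
  size : 2 + σ * d ℕ.≤ n
  size = Finₚ.injective⇒≤ {f = vertexAt ∘ nth} (nth-injective ∘ vertexAt-injective)
    where
    nth : Fin (2 + σ * d) → Slot σ d
    nth zero          = origin
    nth (suc zero)    = root
    nth (suc (suc i)) = at (proj₁ (remQuot {σ} d i)) (proj₂ (remQuot {σ} d i))
    nth-injective : ∀ {i j} → nth i ≡ nth j → i ≡ j
    nth-injective {zero}        {zero}        _  = refl
    nth-injective {zero}        {suc zero}    ()
    nth-injective {zero}        {suc (suc _)} ()
    nth-injective {suc zero}    {suc (suc _)} ()
    nth-injective {suc (suc _)} {zero}        ()
    nth-injective {suc (suc _)} {suc zero}    ()
    nth-injective {suc zero}    {suc zero}    _  = refl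
    nth-injective {suc (suc i)} {suc (suc j)} eq = cong (λ i → suc (suc i))
      (trans (sym (Finₚ.combine-remQuot {σ} d i))
        (trans (at-cong eq) (Finₚ.combine-remQuot {σ} d j)))
      where
      at-cong : ∀ {q q′ : Fin σ} {k k′ : Fin d} → Slot.at q k ≡ at q′ k′ → combine q k ≡ combine q′ k′
      at-cong refl = refl

  open Strip d

  spine-slotPos : ∀ q → slotPos (slot (s q)) ≡ spinePos (toℕ q)
  spine-slotPos zero    = cong slotPos (slot-unique {u = root} refl)
  spine-slotPos (suc q) with k , block≡ , k-last ← successor-in-block q =
    trans (cong slotPos (slot-unique block≡))
      (trans (last-spinePos (inject₁ q) k k-last)
        (cong (λ m → spinePos (suc m)) (Finₚ.toℕ-inject₁ q)))

  module Lift (base : ℕ) where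
    open Embed d base

    lift : Fin n → ℕ
    lift v = embed (slotPos (slot v))

    JoinedBy : Key σ d → Fin n → Fin n → Set
    JoinedBy κ u v = (lift u ≡ lower κ × lift v ≡ upper κ) ⊎ (lift u ≡ upper κ × lift v ≡ lower κ)

    JoinedBy-sym : ∀ κ {u v} → JoinedBy κ u v → JoinedBy κ v u
    JoinedBy-sym κ (inj₁ (p , q)) = inj₂ (q , p)
    JoinedBy-sym κ (inj₂ (p , q)) = inj₁ (q , p)

    block-joined : ∀ q k {v} → block q k ≡ v → JoinedBy (at q k) (s q) v
    block-joined q k eq rewrite spine-slotPos q | slot-unique {u = at q k} eq = block-ends q k

    spine-joined : ∀ q v → s q ~ v → ∃[ κ ] JoinedBy κ (s q) v
    spine-joined q v sq~v with Block.complete q (~⇒∈ sq~v)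
    ... | inj₂ (k , eq) = at q k , block-joined q k eq
    spine-joined zero    v _ | inj₁ refl = root , inj₁
      (cong (embed ∘ slotPos) (slot-unique {u = root} refl) ,
       cong (embed ∘ slotPos) (slot-unique {u = origin} refl))
    -- The edge to the preceding spine vertex was created in that vertex's block, where its ends
    -- appear in the other order.
    spine-joined (suc q) v _ | inj₁ refl with k , block≡ , _ ← successor-in-block q =
      at (inject₁ q) k , JoinedBy-sym (at (inject₁ q) k) (block-joined (inject₁ q) k block≡)

    -- One of the ends is a spine vertex, because the only neighbour of a leaf is one.
    edge-joined : ∀ u v → u ~ v → ∃[ κ ] JoinedBy κ u v
    edge-joined u v u~v = joined (spine-or-leaf u)
      where
      reversed : ∀ q → v ≡ s q → ∃[ κ ] JoinedBy κ u v
      reversed q refl = let κ , joined = spine-joined q u (~-sym u~v) in κ , JoinedBy-sym κ joined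
      direct : ∀ q → s q ≡ u → ∃[ κ ] JoinedBy κ u v
      direct q refl = spine-joined q v u~v
      joined : (∃[ q ] s q ≡ u) ⊎ IsLeaf u → ∃[ κ ] JoinedBy κ u v
      joined (inj₁ (q , sq≡u)) = direct q sq≡u
      joined (inj₂ leaf)       = let q , u~sq = leaf-attached u leaf in
                                 reversed q (leaf-unique leaf u~v u~sq)

-- Overlaying rotated zigzags

-- Deleting a missed value from the codomain would leave an injection into a smaller set.
injective⇒surjective : ∀ {n} (f : Fin n → Fin n) → Injective _≡_ _≡_ f → ∀ y → ∃[ x ] f x ≡ y
injective⇒surjective {suc n} f f-injective y with Finₚ.any? (λ x → f x Finₚ.≟ y)
... | yes found = found
... | no  missed = ⊥-elim (ℕₚ.<-irrefl refl (Finₚ.injective⇒≤ {f = λ x → Fin.punchOut (avoid x)}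
  (λ {i} {j} eq → f-injective (Finₚ.punchOut-injective (avoid i) (avoid j) eq))))
  where
  avoid : ∀ x → y ≢ f x
  avoid x eq = missed (x , sym eq)

injective⇒permutation : ∀ {n} (f : Fin n → Fin n) → Injective _≡_ _≡_ f → Permutation′ n
injective⇒permutation f f-injective =
  permutation f (λ y → proj₁ (preimage y)) (λ y → proj₂ (preimage y))
    (λ x → f-injective (proj₂ (preimage (f x))))
  where preimage = injective⇒surjective f f-injective

length≤ : ∀ {A : Set} {N} (f : A → Fin N) (xs : List A) →
          AllPairs (λ a b → f a ≢ f b) xs → length xs ℕ.≤ N
length≤ f xs pairs = subst (ℕ._≤ _) (length-map f xs)
  (Finₚ.injective⇒≤ (lookup-injective (AllPairsₚ.map⁺ pairs)))

-- The interface between one caterpillar and the overlay: positions before reduction modulo `n`,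
-- with the sums of the ends of edges among `Δ` consecutive values from `2 * base - 1` on.
record Zigzag {n} .{{_ : ℕ.NonZero n}} (T : Graph n) (Δ base : ℕ) : Set where
  field
    σ d          : ℕ
    lift         : Fin n → ℕ
    lower upper  : Key σ d → ℕ
    lower+span   : ∀ κ → lower κ + span κ ≡ upper κ
    span<n       : ∀ (κ : Key σ d) → span κ ℕ.< n
    window-lower : ∀ κ → 2 * base ℕ.≤ suc (lower κ + upper κ)
    window-upper : ∀ κ → suc (lower κ + upper κ) ℕ.< 2 * base + Δ
    %-injective  : ∀ {u v} → lift u % n ≡ lift v % n → u ≡ v
    joined       : ∀ u v → Graph._~_ T u v → ∃[ κ ]
                   ((lift u ≡ lower κ × lift v ≡ upper κ) ⊎ (lift u ≡ upper κ × lift v ≡ lower κ))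

zigzag : ∀ {n} .{{_ : ℕ.NonZero n}} {T : Graph n} {Δ} base →
         n ℕ.≤ base → RegularCaterpillar Δ T → Zigzag T Δ base
zigzag {n} {T} {suc d} base n≤base record
  { caterpillar = record { connected = connected ; spine = record
      { σ = suc σ′ ; vertex = s ; injective = s-injective
      ; nonLeaf = nonLeaf ; covers = covers ; path = path } }
  ; 2≤Δ = s≤s 1≤d ; regular = regular } = record
  { σ            = suc σ′
  ; d            = d
  ; lift         = lift
  ; lower        = lower
  ; upper        = upper
  ; lower+span   = lower+span L≤base
  ; span<n       = λ κ → ℕₚ.<-≤-trans (span< κ) size
  ; window-lower = window-lower L≤base
  ; window-upper = λ κ → ℕₚ.≤-<-trans (window-upper L≤base κ) (ℕₚ.+-monoʳ-< (2 * base) (ℕₚ.n<1+n d))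
  ; %-injective  = λ {u} {v} eq → slot-injective (slotPos-injective (slot u) (slot v)
                     (embed-%-injective L≤base L+R<n _ _
                       (slotPos-within (slot u)) (slotPos-within (slot v)) eq))
  ; joined       = edge-joined
  }
  where
  open Order T connected s s-injective nonLeaf covers path regular 1≤d
  open Lift base
  open Strip d
  open Embed d base
  L+R<n : L (suc σ′) + R (suc σ′) ℕ.< n
  L+R<n = subst (ℕ._< n) (sym (L+R (suc σ′))) (subst (λ e → suc e ℕ.< n) (ℕₚ.*-comm (suc σ′) d) size)
  -- The zigzag extends less than `n` to the left, so a base of at least `n` leaves enough room.
  L≤base : L (suc σ′) ℕ.≤ base
  L≤base = ℕₚ.≤-trans (ℕₚ.m≤m+n (L (suc σ′)) (R (suc σ′))) (ℕₚ.≤-trans (ℕₚ.<⇒≤ L+R<n) n≤base)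
zigzag base n≤base record { caterpillar = record { spine = record { σ = zero } } ; 0<σ = () }

m≤2*⌈m/2⌉ : ∀ m → m ℕ.≤ 2 * ⌈ m /2⌉
m≤2*⌈m/2⌉ m = begin
  m                      ≡⟨ ℕₚ.⌊n/2⌋+⌈n/2⌉≡n m ⟨
  ℕ.⌊ m /2⌋ + ⌈ m /2⌉    ≤⟨ ℕₚ.+-mono-≤ (ℕₚ.⌊n/2⌋≤⌈n/2⌉ m) (ℕₚ.m≤m+n ⌈ m /2⌉ 0) ⟩
  2 * ⌈ m /2⌉            ∎
  where open ℕₚ.≤-Reasoning

-- Rotation by `r i` shifts the window of sums by `2 * r i`. Windows can thus be moved by even
-- amounts only, which is why `apart` rounds half the width up.
module Overlay {n h D : ℕ} .{{_ : ℕ.NonZero n}} (C : Fin h → Graph n) (Δ r : Fin h → ℕ)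
  (Z : ∀ i → Zigzag (C i) (Δ i) (n + r i))
  (D≤n : D ℕ.≤ n) (width : ∀ i → 2 * r i + Δ i ℕ.≤ D)
  (apart : ∀ i j → i ≢ j → r i + ⌈ Δ i /2⌉ ℕ.≤ r j ⊎ r j + ⌈ Δ j /2⌉ ℕ.≤ r i) where

  module Z (i : Fin h) = Zigzag (Z i)

  EdgeKey : Fin h → Set
  EdgeKey i = Key (Z.σ i) (Z.d i)

  S : ∀ i → EdgeKey i → ℕ
  S i κ = Z.lower i κ + Z.upper i κ

  -- All the numbers `suc (S i κ)` lie in the window of width `D` that starts at `2 * n`.
  S-close : ∀ i j κ λ′ → S i κ ℕ.< S j λ′ + D
  S-close i j κ λ′ = ℕₚ.≤-pred (begin-strict
    suc (S i κ)                 <⟨ Z.window-upper i κ ⟩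
    2 * (n + r i) + Δ i         ≡⟨ regroup n (r i) (Δ i) ⟩
    2 * n + (2 * r i + Δ i)     ≤⟨ ℕₚ.+-mono-≤ (ℕₚ.*-monoʳ-≤ 2 (ℕₚ.m≤m+n n (r j))) (width i) ⟩
    2 * (n + r j) + D           ≤⟨ ℕₚ.+-monoˡ-≤ D (Z.window-lower j λ′) ⟩
    suc (S j λ′) + D            ∎)
    where
    open ℕₚ.≤-Reasoning
    regroup : ∀ n r Δ → 2 * (n + r) + Δ ≡ 2 * n + (2 * r + Δ)
    regroup = solve-∀

  S-close-n : ∀ i j κ λ′ → S i κ ℕ.< S j λ′ + n
  S-close-n i j κ λ′ = ℕₚ.<-≤-trans (S-close i j κ λ′) (ℕₚ.+-monoʳ-≤ (S j λ′) D≤n)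

  S-< : ∀ i j κ λ′ → r i + ⌈ Δ i /2⌉ ℕ.≤ r j → S i κ ℕ.< S j λ′
  S-< i j κ λ′ r≤ = ℕₚ.≤-pred (begin-strict
    suc (S i κ)                        <⟨ Z.window-upper i κ ⟩
    2 * (n + r i) + Δ i                ≤⟨ ℕₚ.+-monoʳ-≤ (2 * (n + r i)) (m≤2*⌈m/2⌉ (Δ i)) ⟩
    2 * (n + r i) + 2 * ⌈ Δ i /2⌉      ≡⟨ regroup n (r i) ⌈ Δ i /2⌉ ⟩
    2 * (n + (r i + ⌈ Δ i /2⌉))        ≤⟨ ℕₚ.*-monoʳ-≤ 2 (ℕₚ.+-monoʳ-≤ n r≤) ⟩
    2 * (n + r j)                      ≤⟨ Z.window-lower j λ′ ⟩
    suc (S j λ′)                       ∎)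
    where
    open ℕₚ.≤-Reasoning
    regroup : ∀ n r c → 2 * (n + r) + 2 * c ≡ 2 * (n + (r + c))
    regroup = solve-∀

  residueOf : ∀ i → Fin n → Fin n
  residueOf i v = fromℕ< (m%n<n (Z.lift i v) n)

  toℕ-residueOf : ∀ i v → toℕ (residueOf i v) ≡ Z.lift i v % n
  toℕ-residueOf i v = Finₚ.toℕ-fromℕ< (m%n<n (Z.lift i v) n)

  place : ∀ i → Permutation′ n
  place i = injective⇒permutation (residueOf i) λ {u} {v} eq → Z.%-injective i
    (trans (sym (toℕ-residueOf i u)) (trans (cong toℕ eq) (toℕ-residueOf i v)))

  PlacedEdge : ∀ i → EdgeKey i → ℕ → ℕ → Set
  PlacedEdge i κ x y = Ends x y (Z.lower i κ) (Z.upper i κ)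

  placed : ∀ i u v → Graph._~_ (C i) u v →
           ∃[ κ ] PlacedEdge i κ (toℕ (place i ⟨$⟩ʳ u)) (toℕ (place i ⟨$⟩ʳ v))
  placed i u v u~v with Z.joined i u v u~v
  ... | κ , inj₁ (p , q) = κ , inj₁
    (trans (toℕ-residueOf i u) (cong (_% n) p) , trans (toℕ-residueOf i v) (cong (_% n) q))
  ... | κ , inj₂ (p , q) = κ , inj₂
    (trans (toℕ-residueOf i u) (cong (_% n) p) , trans (toℕ-residueOf i v) (cong (_% n) q))

  -- A common edge would make the ends of the two intervals congruent, in the same or in the
  -- reversed order. The first is excluded by the disjoint windows, the second by the width of all
  -- windows together.
  disjoint< : ∀ i j κ λ′ x y → r i + ⌈ Δ i /2⌉ ℕ.≤ r j → PlacedEdge i κ x y → ¬ PlacedEdge j λ′ x y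
  disjoint< i j κ λ′ x y r≤ = contradict
    where
    same : Z.lower i κ % n ≡ Z.lower j λ′ % n → ¬ Z.upper i κ % n ≡ Z.upper j λ′ % n
    same = ¬congruent< (Z.lower+span i κ) (Z.lower+span j λ′)
      (0<span κ) (0<span λ′) (Z.span<n i κ) (Z.span<n j λ′)
      (S-< i j κ λ′ r≤) (S-close-n j i λ′ κ)
    opposite : Z.lower i κ % n ≡ Z.upper j λ′ % n → ¬ Z.upper i κ % n ≡ Z.lower j λ′ % n
    opposite = ¬reversed (Z.lower+span i κ) (Z.lower+span j λ′)
      (0<span κ) (0<span λ′) (Z.span<n i κ) (Z.span<n j λ′)
      (S-close-n i j κ λ′) (S-close-n j i λ′ κ)
    contradict : PlacedEdge i κ x y → ¬ PlacedEdge j λ′ x y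
    contradict (inj₁ (p , q)) (inj₁ (p′ , q′)) = same     (trans (sym p) p′) (trans (sym q) q′)
    contradict (inj₂ (p , q)) (inj₂ (p′ , q′)) = same     (trans (sym q) q′) (trans (sym p) p′)
    contradict (inj₁ (p , q)) (inj₂ (p′ , q′)) = opposite (trans (sym p) p′) (trans (sym q) q′)
    contradict (inj₂ (p , q)) (inj₁ (p′ , q′)) = opposite (trans (sym q) q′) (trans (sym p) p′)

  disjoint : ∀ i j κ λ′ x y → i ≢ j → PlacedEdge i κ x y → ¬ PlacedEdge j λ′ x y
  disjoint i j κ λ′ x y i≢j p q with apart i j i≢j
  ... | inj₁ r≤ = disjoint< i j κ λ′ x y r≤ p q
  ... | inj₂ r≤ = disjoint< j i λ′ κ x y r≤ q p

  Joined : Fin n → Fin n → Set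
  Joined u v = ∃[ i ] Graph._~_ (C i) (place i ⟨$⟩ˡ u) (place i ⟨$⟩ˡ v)

  joined? : ∀ u v → Dec (Joined u v)
  joined? u v = Finₚ.any? λ i → T? (Graph.adjacent (C i) (place i ⟨$⟩ˡ u) (place i ⟨$⟩ˡ v))

  Joined-sym : ∀ {u v} → Joined u v → Joined v u
  Joined-sym (i , u~v) = i , Neighbours.~-sym (C i) u~v

  host : Graph n
  host = record
    { adjacent    = λ u v → isYes (joined? u v)
    ; symmetric   = λ u v → trans (isYes≗does (joined? u v))
                      (trans (does-⇔ (mk⇔ Joined-sym Joined-sym) (joined? u v) (joined? v u))
                             (sym (isYes≗does (joined? v u))))
    ; irreflexive = λ v → trans (isYes≗does (joined? v v)) (dec-false (joined? v v) λ (i , v~v) →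
                      subst T (Graph.irreflexive (C i) (place i ⟨$⟩ˡ v)) v~v)
    }

  packing : Packing C host
  packing = record
    { place        = place
    ; contained    = λ i u v u~v → fromWitness {a? = joined? _ _} (i , subst₂ (Graph._~_ (C i))
                       (sym (inverseˡ (place i))) (sym (inverseˡ (place i))) u~v)
    ; edgeDisjoint = λ i j i≢j u v u′ v′ u~v u′~v′ (u≡ , v≡) →
        let κ  , p  = placed i u v u~v
            λ′ , p′ = placed j u′ v′ u′~v′
        in disjoint i j κ λ′ _ _ i≢j p
             (subst₂ (PlacedEdge j λ′) (sym (cong toℕ u≡)) (sym (cong toℕ v≡)) p′)
    }

  open Edge
  open Parabola host

  record Trace (e : Edge host) : Set where
    field
      graph : Fin h
      key   : EdgeKey graph
      ends  : PlacedEdge graph key (toℕ (tail e)) (toℕ (head e))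

  trace : ∀ e → Trace e
  trace e = record { graph = i ; key = proj₁ found
                   ; ends = subst₂ (λ u v → PlacedEdge i (proj₁ found) (toℕ u) (toℕ v))
                              (inverseʳ (place i)) (inverseʳ (place i)) (proj₂ found) }
    where
    witness : Joined (tail e) (head e)
    witness = toWitness (joined e)
    i : Fin h
    i = proj₁ witness
    found = placed i _ _ (proj₂ witness)

  -- Within one caterpillar the span determines the key and so the unordered pair of ends; listing
  -- the smaller end first fixes the order.
  Trace-injective : ∀ {e f} (τ : Trace e) (τ′ : Trace f) → Trace.graph τ ≡ Trace.graph τ′ →
                    span (Trace.key τ) ≡ span (Trace.key τ′) → e ≡ f
  Trace-injective {e} {f} record { graph = i ; key = κ ; ends = p }
                  record { graph = .i ; key = λ′ ; ends = q } refl eq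
    with refl ← span-injective {κ = κ} {λ′} eq = match p q
    where
    edge : toℕ (tail e) ≡ toℕ (tail f) → toℕ (head e) ≡ toℕ (head f) → e ≡ f
    edge p q = Edge-≡ (Finₚ.toℕ-injective p) (Finₚ.toℕ-injective q)
    twisted : toℕ (tail e) ≡ toℕ (head f) → toℕ (head e) ≡ toℕ (tail f) → ⊥
    twisted p q = ℕₚ.<-asym (tail<head e) (subst₂ ℕ._<_ (sym q) (sym p) (tail<head f))
    match : PlacedEdge i κ (toℕ (tail e)) (toℕ (head e)) →
            PlacedEdge i κ (toℕ (tail f)) (toℕ (head f)) → e ≡ f
    match (inj₁ (p , q)) (inj₁ (p′ , q′)) = edge (trans p (sym p′)) (trans q (sym q′))
    match (inj₂ (p , q)) (inj₂ (p′ , q′)) = edge (trans p (sym p′)) (trans q (sym q′))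
    match (inj₁ (p , q)) (inj₂ (p′ , q′)) = ⊥-elim (twisted (trans p (sym q′)) (trans q (sym p′)))
    match (inj₂ (p , q)) (inj₁ (p′ , q′)) = ⊥-elim (twisted (trans p (sym q′)) (trans q (sym p′)))

  spanOf : Edge host → ℕ
  spanOf e = span (Trace.key (trace e))

  open Drawing drawing using (Crossing; SameCrossing)

  traces-close : ∀ {e f} (τ : Trace e) (τ′ : Trace f) → ¬ edgeSameSide e f → ¬ edgeSameSide f e →
                 span (Trace.key τ) ℕ.< span (Trace.key τ′) + D ×
                 span (Trace.key τ′) ℕ.< span (Trace.key τ) + D
  traces-close {e} {f} record { graph = i ; key = κ ; ends = p }
               record { graph = j ; key = λ′ ; ends = q } ¬ef ¬fe =
    conclude (nested-or-close (Z.lower+span i κ) (Z.lower+span j λ′)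
      (0<span κ) (0<span λ′) (Z.span<n i κ) (Z.span<n j λ′)
      (S-close i j κ λ′) (S-close j i λ′ κ))
    where
    lower≤upper : ∀ i κ → Z.lower i κ ℕ.≤ Z.upper i κ
    lower≤upper i κ = subst (Z.lower i κ ℕ.≤_) (Z.lower+span i κ) (ℕₚ.m≤m+n (Z.lower i κ) (span κ))
    upper< : ∀ i κ → Z.upper i κ ℕ.< Z.lower i κ + n
    upper< i κ = subst (ℕ._< Z.lower i κ + n) (Z.lower+span i κ) (ℕₚ.+-monoʳ-< (Z.lower i κ) (Z.span<n i κ))
    conclude : (Z.lower i κ ℕ.≤ Z.lower j λ′ × Z.upper j λ′ ℕ.≤ Z.upper i κ) ⊎
               (Z.lower j λ′ ℕ.≤ Z.lower i κ × Z.upper i κ ℕ.≤ Z.upper j λ′) ⊎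
               (span κ ℕ.< span λ′ + D × span λ′ ℕ.< span κ + D) →
               span κ ℕ.< span λ′ + D × span λ′ ℕ.< span κ + D
    conclude (inj₁ (l , u)) =
      ⊥-elim (¬ef (nested⇒SameSide (tail<head e) p q (upper< i κ) l (lower≤upper j λ′) u))
    conclude (inj₂ (inj₁ (l , u))) =
      ⊥-elim (¬fe (nested⇒SameSide (tail<head f) q p (upper< j λ′) l (lower≤upper i κ) u))
    conclude (inj₂ (inj₂ close)) = close

  -- A crossing on `e` is coded by the caterpillar of the other edge and the difference of the
  -- spans, which lies strictly between `- D` and `D`.
  planar : KPlanar (h * (D + D)) host
  planar = record { drawing = drawing ; crossedAtMost = λ e cs distinct →
    length≤ (code e) cs (AllPairs.map (λ {c} {d} c≉d eq → c≉d (code-injective e c d eq)) distinct) }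
    where
    module _ (e : Edge host) where
      t : ℕ
      t = spanOf e
      close : ∀ (c : Crossing e) →
              t ℕ.< spanOf (Crossing.other c) + D × spanOf (Crossing.other c) ℕ.< t + D
      close c = traces-close (trace e) (trace (Crossing.other c))
        (crossing⇒¬sameSide c) (crossing⇒¬sameSide′ c)
      offset : Crossing e → ℕ
      -- Adding `D` before subtracting makes the truncated subtraction exact, hence injective.
      offset c = spanOf (Crossing.other c) + D ∸ t
      offset< : ∀ c → offset c ℕ.< D + D
      offset< c = ℕₚ.+-cancelʳ-< t _ _ (begin-strict
        offset c + t                    ≡⟨ ℕₚ.m∸n+n≡m (ℕₚ.<⇒≤ (proj₁ (close c))) ⟩
        spanOf (Crossing.other c) + D   <⟨ ℕₚ.+-monoˡ-< D (proj₂ (close c)) ⟩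
        t + D + D                       ≡⟨ ℕₚ.+-assoc t D D ⟩
        t + (D + D)                     ≡⟨ ℕₚ.+-comm t (D + D) ⟩
        D + D + t                       ∎)
        where open ℕₚ.≤-Reasoning
      code : Crossing e → Fin (h * (D + D))
      code c = combine (Trace.graph (trace (Crossing.other c))) (fromℕ< (offset< c))
      code-injective : ∀ c d → code c ≡ code d → SameCrossing c d
      code-injective c d eq = sameOther⇒SameCrossing c d
        (Trace-injective (trace (Crossing.other c)) (trace (Crossing.other d)) (proj₁ parts)
          (ℕₚ.+-cancelʳ-≡ D _ _ (ℕₚ.∸-cancelʳ-≡ (ℕₚ.<⇒≤ (proj₁ (close c))) (ℕₚ.<⇒≤ (proj₁ (close d)))
            (Finₚ.fromℕ<-injective _ _ (offset< c) (offset< d) (proj₂ parts)))))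
        where parts = Finₚ.combine-injective (Trace.graph (trace (Crossing.other c))) (fromℕ< (offset< c))
                        (Trace.graph (trace (Crossing.other d))) (fromℕ< (offset< d)) eq

-- The choice of the rotations and the bound on the crossings

prefixSum : ∀ {m} → (Fin m → ℕ) → Fin m → ℕ
prefixSum f zero    = 0
prefixSum f (suc j) = f zero + prefixSum (f ∘ suc) j

prefixSum+≤sum : ∀ {m} (f : Fin m → ℕ) j → prefixSum f j + f j ℕ.≤ sum f
prefixSum+≤sum f zero    = ℕₚ.m≤m+n (f zero) _
prefixSum+≤sum f (suc j) = ℕₚ.≤-trans (ℕₚ.≤-reflexive (ℕₚ.+-assoc (f zero) _ _))
  (ℕₚ.+-monoʳ-≤ (f zero) (prefixSum+≤sum (f ∘ suc) j))

prefixSum+≤prefixSum : ∀ {m} (f : Fin m → ℕ) {j k} → j Fin.< k → prefixSum f j + f j ℕ.≤ prefixSum f k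
prefixSum+≤prefixSum f {zero}  {suc k} _         = ℕₚ.m≤m+n (f zero) _
prefixSum+≤prefixSum f {suc j} {suc k} (s≤s j<k) = ℕₚ.≤-trans (ℕₚ.≤-reflexive (ℕₚ.+-assoc (f zero) _ _))
  (ℕₚ.+-monoʳ-≤ (f zero) (prefixSum+≤prefixSum (f ∘ suc) j<k))

sum≤* : ∀ {m} (f : Fin m → ℕ) b → (∀ j → f j ℕ.≤ b) → sum f ℕ.≤ m * b
sum≤* {zero}  f b f≤b = z≤n
sum≤* {suc m} f b f≤b = ℕₚ.+-mono-≤ (f≤b zero) (sum≤* (f ∘ suc) b (f≤b ∘ suc))

-- The window of the first, largest, degree comes last: it is the only one whose width is
-- not rounded up to an even number.
rotation : ∀ {m} → (Fin (suc m) → ℕ) → Fin (suc m) → ℕ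
rotation f zero    = sum (f ∘ suc)
rotation f (suc j) = prefixSum (f ∘ suc) j

rotation-apart : ∀ {m} (f : Fin (suc m) → ℕ) i j → i ≢ j →
                 rotation f i + f i ℕ.≤ rotation f j ⊎ rotation f j + f j ℕ.≤ rotation f i
rotation-apart f zero    zero    i≢j = ⊥-elim (i≢j refl)
rotation-apart f zero    (suc j) _   = inj₂ (prefixSum+≤sum (f ∘ suc) j)
rotation-apart f (suc i) zero    _   = inj₁ (prefixSum+≤sum (f ∘ suc) i)
rotation-apart f (suc i) (suc j) i≢j with Finₚ.<-cmp i j
... | tri< i<j _ _  = inj₁ (prefixSum+≤prefixSum (f ∘ suc) i<j)
... | tri≈ _ refl _ = ⊥-elim (i≢j refl)
... | tri> _ _ j<i  = inj₂ (prefixSum+≤prefixSum (f ∘ suc) j<i)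

theorem3 : ∃[ c ] 0 ℕ.< c ×
    ((m n : ℕ) → let h = suc m in
    (C : Fin h → Graph n) (Δ : Fin h → ℕ) →
    (∀ i → RegularCaterpillar (Δ i) (C i)) →
    (∀ i j → i Fin.≤ j → Δ j ℕ.≤ Δ i) →
    Δ zero ℕ.≤ n ∸ h →
    sum Δ ℕ.≤ n ∸ 1 →
    2 * sum (λ (i : Fin m) → ⌈ Δ (suc i) /2⌉) ℕ.< n ∸ (Δ zero ∸ 1) →
    ∃[ k ] k ℕ.≤ c * Δ zero * h ^ 2 ×
    (∃[ G ] Packing C G × KPlanar k G))
-- The constant comes from `h (D + D)` crossings with `D` at most `2 h (Δ zero)`.
theorem3 = 4 , s≤s z≤n , pack
  where
  pack : (m n : ℕ) (C : Fin (suc m) → Graph n) (Δ : Fin (suc m) → ℕ) →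
    (∀ i → RegularCaterpillar (Δ i) (C i)) →
    (∀ i j → i Fin.≤ j → Δ j ℕ.≤ Δ i) →
    Δ zero ℕ.≤ n ∸ suc m →
    sum Δ ℕ.≤ n ∸ 1 →
    2 * sum (λ (i : Fin m) → ⌈ Δ (suc i) /2⌉) ℕ.< n ∸ (Δ zero ∸ 1) →
    ∃[ k ] k ℕ.≤ 4 * Δ zero * suc m ^ 2 ×
    (∃[ G ] Packing C G × KPlanar k G)
  -- A spine vertex exists, so `n` is not 0 and reduction modulo `n` makes sense.
  pack m zero C Δ cat _ _ _ _
    with () ← RegularCaterpillar.vertex (cat zero) (fromℕ< (RegularCaterpillar.0<σ (cat zero)))
  pack m n@(suc _) C Δ cat decreasing _ _ narrow = suc m * (D + D) , k≤ , host , packing , planar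
    where
    half r : Fin (suc m) → ℕ
    half i = ⌈ Δ i /2⌉
    r = rotation half
    D : ℕ
    -- The right end of the last window, relative to the start of the first.
    D = 2 * r zero + Δ zero
    D≤n : D ℕ.≤ n
    D≤n = begin
      -- The strictness of `narrow` makes up for the 1 by which `Δ zero` may exceed `Δ zero ∸ 1`.
      2 * r zero + Δ zero                  ≤⟨ ℕₚ.+-monoʳ-≤ (2 * r zero) (ℕₚ.m≤n+m∸n (Δ zero) 1) ⟩
      2 * r zero + suc (Δ zero ∸ 1)        ≡⟨ ℕₚ.+-suc (2 * r zero) (Δ zero ∸ 1) ⟩
      suc (2 * r zero + (Δ zero ∸ 1))      ≤⟨ ℕₚ.m≤o∸n⇒m+n≤o (suc (2 * r zero)) Δ₀∸1≤n narrow ⟩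
      n                                    ∎
      where
      open ℕₚ.≤-Reasoning
      Δ₀∸1≤n : Δ zero ∸ 1 ℕ.≤ n
      -- If the subtraction in `narrow` were truncated, its right side would be 0 and nothing could
      -- lie below it.
      Δ₀∸1≤n = ℕₚ.<⇒≤ (ℕₚ.m∸n≢0⇒n<m (ℕₚ.m<n⇒n≢0 narrow))
    width : ∀ i → 2 * r i + Δ i ℕ.≤ D
    width zero    = ℕₚ.≤-refl
    width (suc j) = begin
      2 * r (suc j) + Δ (suc j)            ≤⟨ ℕₚ.+-monoʳ-≤ (2 * r (suc j)) (m≤2*⌈m/2⌉ (Δ (suc j))) ⟩
      2 * r (suc j) + 2 * half (suc j)     ≡⟨ ℕₚ.*-distribˡ-+ 2 (r (suc j)) (half (suc j)) ⟨
      2 * (r (suc j) + half (suc j))       ≤⟨ ℕₚ.*-monoʳ-≤ 2 (prefixSum+≤sum (half ∘ suc) j) ⟩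
      2 * r zero                           ≤⟨ ℕₚ.m≤m+n (2 * r zero) (Δ zero) ⟩
      D                                    ∎
      where open ℕₚ.≤-Reasoning
    open Overlay C Δ r (λ i → zigzag (n + r i) (ℕₚ.m≤m+n n (r i)) (cat i))
      D≤n width (rotation-apart half)
    k≤ : suc m * (D + D) ℕ.≤ 4 * Δ zero * suc m ^ 2
    k≤ = begin
      suc m * (D + D)                                      ≤⟨ ℕₚ.*-monoʳ-≤ (suc m) (ℕₚ.+-mono-≤ D≤ D≤) ⟩
      suc m * (2 * suc m * Δ zero + 2 * suc m * Δ zero)    ≡⟨ regroup (suc m) (Δ zero) ⟩
      4 * Δ zero * suc m ^ 2                               ∎
      where
      open ℕₚ.≤-Reasoning
      regroup : ∀ h x → h * (2 * h * x + 2 * h * x) ≡ 4 * x * (h * (h * 1))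
      regroup = solve-∀
      regroup′ : ∀ m x → 2 * (m * x) + x + x ≡ 2 * suc m * x
      regroup′ = solve-∀
      half≤ : ∀ j → half (suc j) ℕ.≤ Δ zero
      half≤ j = ℕₚ.≤-trans (ℕₚ.⌈n/2⌉≤n (Δ (suc j))) (decreasing zero (suc j) z≤n)
      D≤ : D ℕ.≤ 2 * suc m * Δ zero
      D≤ = begin
        2 * r zero + Δ zero               ≤⟨ ℕₚ.+-monoˡ-≤ (Δ zero) (ℕₚ.*-monoʳ-≤ 2 (sum≤* _ (Δ zero) half≤)) ⟩
        2 * (m * Δ zero) + Δ zero         ≤⟨ ℕₚ.m≤m+n _ (Δ zero) ⟩
        2 * (m * Δ zero) + Δ zero + Δ zero ≡⟨ regroup′ m (Δ zero) ⟩
        2 * suc m * Δ zero                ∎
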